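{- Let $k \geq 4$ be an integer and let $\pi = (d_1, \ldots, d_n)$ be a sequence of nonnegative integers with $n$ even. Suppose that both $\pi$ and $\pi - k = (d_1 - k, \ldots, d_n - k)$ are graphic. Then there is a simple graph $G$ realizing $\pi$ that contains pairwise edge-disjoint spanning subgraphs $F_0, F_1, F_2, F_3, F_4$, where $F_0$ is a $(k-4)$-factor of $G$ and each of $F_1, F_2, F_3, F_4$ is a $1$-factor (perfect matching) of $G$.
   Context: A sequence $\pi = (d_1, \ldots, d_n)$ of nonnegative integers is graphic if there is a simple graph $G$ on vertex set $\{v_1,\dots,v_n\}$ with $\deg_G(v_i) = d_i$ for all $i$; such a $G$ is said to realize $\pi$. For an integer $k$, $\pi - k$ denotes the sequence $(d_1 - k, \ldots, d_n - k)$. A $j$-factor of a graph $G$ is a spanning $j$-regular subgraph of $G$; a $1$-factor is a perfect matching. -}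

module Defs where

open import Data.Nat using (ℕ; _+_; _∸_; _≤_)
open import Data.Bool using (Bool; true; false; if_then_else_; T)
open import Data.Fin using (Fin)
open import Data.List using (List; sum; map; filterᵇ; length)
open import Data.List using () renaming (allFin to allFinL)
open import Data.Product using (Σ; _×_; ∃)
open import Relation.Binary.PropositionalEquality using (_≡_)
open import Relation.Nullary using (¬_)

record Graph (n : ℕ) : Set where
  field
    adj   : Fin n → Fin n → Bool
    sym   : ∀ i j → adj i j ≡ adj j i
    irrefl : ∀ i → adj i i ≡ false
open Graph public

deg : ∀ {n} → Graph n → Fin n → ℕ
deg {n} G i = length (filterᵇ (adj G i) (allFinL n))

Realizes : ∀ {n} → Graph n → (Fin n → ℕ) → Set
Realizes G d = ∀ i → deg G i ≡ d i

Graphic : ∀ {n} → (Fin n → ℕ) → Set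
Graphic {n} d = Σ (Graph n) λ G → Realizes G d

-- the sequence π - k is a sequence of nonnegative integers which is graphic;
-- over ℕ this requires k ≤ d_i for all i (so truncated subtraction is exact)
MinusGraphic : ∀ {n} → (Fin n → ℕ) → ℕ → Set
MinusGraphic d k = (∀ i → k ≤ d i) × Graphic (λ i → d i ∸ k)

_⊆G_ : ∀ {n} → Graph n → Graph n → Set
H ⊆G G = ∀ i j → T (adj H i j) → T (adj G i j)

Factor : ∀ {n} → ℕ → Graph n → Graph n → Set
Factor j G F = F ⊆G G × (∀ i → deg F i ≡ j)

EdgeDisjoint : ∀ {n} → Graph n → Graph n → Set
EdgeDisjoint H₁ H₂ = ∀ i j → T (adj H₁ i j) → T (adj H₂ i j) → ⊥'
  where open import Data.Empty renaming (⊥ to ⊥')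

{-# OPTIONS --safe #-}
module Submission where

-- By Kundu's theorem we may start from a realization of π with a k-factor. Colour the pairs of vertices:
-- non-edges, edges outside the k-factor, matchings already split off, and red for the rest of the
-- k-factor, a regular graph. By Hall's theorem the red graph is spanned by disjoint edges and odd cycles,
-- and we reduce the number of odd cycles by recolourings that keep all colour degrees: it is enough to
-- make red one edge xv between two odd cycles while losing only red edges at x or v. Let b be the degree
-- outside the k-factor. If b u ≤ b v, u is in one cycle and v in the other, and ux is a red cycle edge,
-- then exchanging colours between u and v along a closed walk of colours makes xv red whenever xv is a
-- non-edge; symmetrically for the edges outside the k-factor. An odd cycle contains a path along which b
-- is monotone, so some red edge ux of one cycle has both its b-values below those of a red edge vy of the
-- other. Hence the four edges between ux and vy lie in matchings; disjoint ones have different colours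
-- (else rotate the colours of a four-cycle), as have incident ones. That needs four matchings,
-- but at most three have been split off so far.

open import Defs hiding (sym)
open import Data.Bool using (Bool; true; false; if_then_else_; _∨_; _∧_; not; T)
import Data.Bool as Bool
open import Data.Empty using (⊥; ⊥-elim)
open import Data.Fin using (Fin; zero; suc; _≟_)
import Data.Fin as Fin
open import Data.Fin.Patterns
open import Data.Fin.Permutation using (transpose)
open import Data.Fin.Permutation.Components using () renaming (transpose to swap)
open import Data.Fin.Properties using (any?; pigeonhole; suc-injective)
open import Data.List using (List; []; _∷_; _++_; length; allFin; filterᵇ; tabulate)
open import Data.List.Membership.Propositional using (_∈_)
open import Data.List.Membership.Propositional.Properties using (∈-allFin; ∈-++⁻; ∈-++⁺ˡ; ∈-++⁺ʳ; ∈-∃++)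
open import Data.List.Properties using (length-++; ++-assoc; length-tabulate)
open import Data.List.Relation.Binary.Permutation.Propositional using (_↭_; prep; ↭-sym; ↭-trans; ↭-refl; ↭-reflexive; ↭⇒↭ₛ; module PermutationReasoning)
open import Data.List.Relation.Binary.Permutation.Propositional.Properties using (∈-resp-↭; ↭-length; ++⁺ˡ; ++⁺ʳ; shift; shifts; ++-comm)
import Data.List.Relation.Binary.Permutation.Setoid.Properties as Setoid↭
open import Data.List.Relation.Unary.All as All using (All; []; _∷_)
open import Data.List.Relation.Unary.All.Properties using () renaming (++⁺ to All-++⁺; ++⁻ to All-++⁻)
open import Data.List.Relation.Unary.AllPairs using ([]; _∷_)
open import Data.List.Relation.Unary.Any using (here; there)
open import Data.List.Relation.Unary.Unique.Propositional using (Unique)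
open import Data.List.Relation.Unary.Unique.Propositional.Properties using (allFin⁺)
open import Data.Maybe using (Maybe; just; nothing)
open import Data.Maybe.Properties using (just-injective; ≡-dec)
open import Data.Nat using (ℕ; zero; suc; pred; _+_; _*_; _∸_; _≤_; _<_; z≤n; s≤s; s≤s⁻¹)
open import Data.Nat.Divisibility using (_∣_; divides)
open import Data.Nat.Properties hiding (_≟_; suc-injective)
open import Data.Nat.Solver using (module +-*-Solver)
open import Data.Product using (Σ; ∃; _×_; _,_; proj₁; proj₂)
open import Data.Sum using (_⊎_; inj₁; inj₂)
open import Data.Unit using (⊤; tt)
open import Function using (_∘_; id; flip)
open import Relation.Binary.PropositionalEquality
open import Relation.Nullary using (¬_; Dec; yes; no; does)
open import Relation.Nullary.Decidable using (dec-true; dec-false; _×-dec_; ¬?)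
open import Algebra.Properties.CommutativeMonoid.Sum +-0-commutativeMonoid using (sum; sum-cong-≗; ∑-distrib-+; ∑-comm; sum-permute; sum-replicate-zero)

-- Finite sums and exchanges

when : Bool → ℕ → ℕ
when b x = if b then x else 0

ind : Bool → ℕ
ind b = when b 1

sum-mono : ∀ {n} {f g : Fin n → ℕ} → (∀ i → f i ≤ g i) → sum f ≤ sum g
sum-mono {zero}  f≤g = z≤n
sum-mono {suc n} f≤g = +-mono-≤ (f≤g zero) (sum-mono (f≤g ∘ suc))

sum-mono-< : ∀ {n} {f g : Fin n → ℕ} → (∀ i → f i ≤ g i) → ∀ i → f i < g i → sum f < sum g
sum-mono-< f≤g zero    f<g = +-mono-<-≤ f<g (sum-mono (f≤g ∘ suc))
sum-mono-< f≤g (suc i) f<g = +-mono-≤-< (f≤g zero) (sum-mono-< (f≤g ∘ suc) i f<g)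

sum-single : ∀ {n} (f : Fin n → ℕ) z → sum (λ i → when (does (i ≟ z)) (f i)) ≡ f z
sum-single {suc n} f zero    = trans (cong (f zero +_) (sum-replicate-zero n)) (+-identityʳ _)
sum-single {suc n} f (suc z) = sum-single (f ∘ suc) z

sum-positive : ∀ {n} (f : Fin n → ℕ) → 0 < sum f → ∃ λ i → 0 < f i
sum-positive {suc n} f 0<s with f zero in eq
... | suc m = zero , subst (0 <_) (sym eq) (s≤s z≤n)
... | zero  = let i , p = sum-positive (f ∘ suc) 0<s in suc i , p

length-filter-tabulate : ∀ {n} {A : Set} (P : A → Bool) (f : Fin n → A) →
  length (filterᵇ P (tabulate f)) ≡ sum (λ i → ind (P (f i)))
length-filter-tabulate {zero}  P f = refl
length-filter-tabulate {suc n} P f with P (f zero)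
... | true  = cong suc (length-filter-tabulate P (f ∘ suc))
... | false = length-filter-tabulate P (f ∘ suc)

swap-left : ∀ {n} (u v : Fin n) → swap u v u ≡ v
swap-left u v rewrite dec-true (u ≟ u) refl = refl

swap-right : ∀ {n} (u v : Fin n) → swap u v v ≡ u
swap-right u v with v ≟ u
... | yes v≡u = v≡u
... | no _ rewrite dec-true (v ≟ v) refl = refl

swap-other : ∀ {n} {u v z : Fin n} → z ≢ u → z ≢ v → swap u v z ≡ z
swap-other {u = u} {v} {z} z≢u z≢v rewrite dec-false (z ≟ u) z≢u | dec-false (z ≟ v) z≢v = refl

sum-swap : ∀ {n} (f : Fin n → ℕ) u v → sum (f ∘ swap u v) ≡ sum f
sum-swap f u v = sym (sum-permute f (transpose u v))

data Position {n} (u v z : Fin n) : Set where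
  at-left  : z ≡ u → Position u v z
  at-right : z ≡ v → Position u v z
  off      : z ≢ u → z ≢ v → Position u v z

position : ∀ {n} (u v z : Fin n) → Position u v z
position u v z with z ≟ u | z ≟ v
... | yes p | _     = at-left p
... | no _  | yes q = at-right q
... | no p  | no q  = off p q

-- Rows u and v of a symmetric array are compared after exchanging the entries in columns u and v.
sum-row-< : ∀ {n} {f g : Fin n → ℕ} (u v x : Fin n) → f u ≡ g v → f v ≡ g u →
  (∀ z → z ≢ u → z ≢ v → f z ≤ g z) → x ≢ u → x ≢ v → f x < g x → sum f < sum g
sum-row-< {f = f} {g} u v x fu fv f≤g x≢u x≢v fx<gx =
  subst (sum f <_) (sum-swap g u v) (sum-mono-< pointwise x (subst (λ z → f x < g z) (sym (swap-other x≢u x≢v)) fx<gx))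
  where
  pointwise : ∀ z → f z ≤ g (swap u v z)
  pointwise z with position u v z
  ... | at-left refl  = ≤-reflexive (trans fu (cong g (sym (swap-left u v))))
  ... | at-right refl = ≤-reflexive (trans fv (cong g (sym (swap-right u v))))
  ... | off p q       = subst (λ y → f z ≤ g y) (sym (swap-other p q)) (f≤g z p q)

∅ : ∀ {n} → Fin n → Bool
∅ _ = false

insert : ∀ {n} → Fin n → (Fin n → Bool) → Fin n → Bool
insert z S i = does (i ≟ z) ∨ S i

insert-here : ∀ {n} (z : Fin n) S → insert z S z ≡ true
insert-here z S rewrite dec-true (z ≟ z) refl = refl

insert-false : ∀ {n} {z i : Fin n} S → i ≢ z → S i ≡ false → insert z S i ≡ false
insert-false {z = z} {i} S i≢z Si rewrite dec-false (i ≟ z) i≢z = Si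

insert-elim : ∀ {n} {z i : Fin n} S → insert z S i ≡ true → i ≡ z ⊎ S i ≡ true
insert-elim {z = z} {i} S p with i ≟ z
... | yes q = inj₁ q
... | no _  = inj₂ p

sum-insert : ∀ {n} (f : Fin n → ℕ) (S : Fin n → Bool) z → S z ≡ false →
  sum (λ i → when (insert z S i) (f i)) ≡ f z + sum (λ i → when (S i) (f i))
sum-insert f S z Sz = trans (sum-cong-≗ pointwise)
  (trans (∑-distrib-+ (λ i → when (does (i ≟ z)) (f i)) (λ i → when (S i) (f i))) (cong (_+ _) (sum-single f z)))
  where
  pointwise : ∀ i → when (insert z S i) (f i) ≡ when (does (i ≟ z)) (f i) + when (S i) (f i)
  pointwise i with i ≟ z
  ... | yes refl rewrite Sz = sym (+-identityʳ _)
  ... | no _     = refl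

-- Exchanging the colours of iu and iv for every i in S.
exchange : ∀ {n} {C : Set} → (Fin n → Bool) → Fin n → Fin n → (Fin n → Fin n → C) → Fin n → Fin n → C
exchange S u v col i j = col (if S j then swap u v i else i) (if S i then swap u v j else j)

-- Over i ∈ S, passing from row u to row v loses one entry a and gains one entry b.
Shift : ∀ {n} {C : Set} → (Fin n → Fin n → C) → Fin n → Fin n → (Fin n → Bool) → C → C → Set
Shift {C = C} col u v S a b = ∀ (φ : C → ℕ) →
  sum (λ i → when (S i) (φ (col u i))) + φ b ≡ sum (λ i → when (S i) (φ (col v i))) + φ a

Shift-∅ : ∀ {n} {C : Set} (col : Fin n → Fin n → C) u v a → Shift col u v ∅ a a
Shift-∅ col u v a φ = refl

-- With each `i` read as an arc from `col u i` to `col v i`, adding `z` puts its arc in front of a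
-- walk of colours from `col v z` to `b`.
Shift-insert : ∀ {n} {C : Set} (col : Fin n → Fin n → C) {u v S z b} → S z ≡ false →
  Shift col u v S (col v z) b → Shift col u v (insert z S) (col u z) b
Shift-insert col {u} {v} {S} {z} {b} Sz sh φ = begin
  sum (λ i → when (insert z S i) (φ (col u i))) + φ b
    ≡⟨ cong (_+ φ b) (sum-insert (φ ∘ col u) S z Sz) ⟩
  φ (col u z) + s + φ b     ≡⟨ +-assoc (φ (col u z)) s (φ b) ⟩
  φ (col u z) + (s + φ b)   ≡⟨ cong (φ (col u z) +_) (sh φ) ⟩
  φ (col u z) + (t + φ (col v z)) ≡⟨ +-comm (φ (col u z)) _ ⟩
  t + φ (col v z) + φ (col u z) ≡⟨ cong (_+ φ (col u z)) (+-comm t _) ⟩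
  φ (col v z) + t + φ (col u z)
    ≡⟨ cong (_+ φ (col u z)) (sym (sum-insert (φ ∘ col v) S z Sz)) ⟩
  sum (λ i → when (insert z S i) (φ (col v i))) + φ (col u z) ∎
  where
  open ≡-Reasoning
  s = sum (λ i → when (S i) (φ (col u i)))
  t = sum (λ i → when (S i) (φ (col v i)))

module _ {n} {C : Set} (col : Fin n → Fin n → C) (col-sym : ∀ i j → col i j ≡ col j i)
         {u v : Fin n} {S : Fin n → Bool} (Su : S u ≡ false) (Sv : S v ≡ false) where

  private
    ex = exchange S u v col

  exchange-sym : ∀ i j → ex i j ≡ ex j i
  exchange-sym i j = col-sym _ _

  exchange-diag : ∀ {c} → (∀ i → col i i ≡ c) → ∀ i → ex i i ≡ c
  exchange-diag d i = d _

  exchange-left : ∀ j → ex u j ≡ col (if S j then v else u) j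
  exchange-left j rewrite Su | swap-left u v = refl

  exchange-right : ∀ j → ex v j ≡ col (if S j then u else v) j
  exchange-right j rewrite Sv | swap-right u v = refl

  exchange-off : ∀ {i j} → i ≢ u → i ≢ v → j ≢ u → j ≢ v → ex i j ≡ col i j
  exchange-off {i} {j} p q r s with S i | S j
  ... | true  | true  = cong₂ col (swap-other p q) (swap-other r s)
  ... | true  | false = cong (col i) (swap-other r s)
  ... | false | true  = cong (λ k → col k j) (swap-other p q)
  ... | false | false = refl

  private
    -- The common sum over `S` is added to both sides; the identity then holds term by term and no
    -- subtraction arises.
    balance : ∀ (φ : C → ℕ) a b →
      sum (λ i → when (S i) (φ (col a i))) ≡ sum (λ i → when (S i) (φ (col b i))) →
      sum (λ j → φ (col (if S j then b else a) j)) ≡ sum (λ j → φ (col a j))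
    balance φ a b eq = +-cancelʳ-≡ (sum (λ i → when (S i) (φ (col a i)))) _ _ (begin
      sum (λ j → φ (col (if S j then b else a) j)) + sum (λ i → when (S i) (φ (col a i)))
        ≡⟨ sym (∑-distrib-+ (λ j → φ (col (if S j then b else a) j)) _) ⟩
      sum (λ j → φ (col (if S j then b else a) j) + when (S j) (φ (col a j)))
        ≡⟨ sum-cong-≗ pointwise ⟩
      sum (λ j → φ (col a j) + when (S j) (φ (col b j)))
        ≡⟨ ∑-distrib-+ (λ j → φ (col a j)) _ ⟩
      sum (λ j → φ (col a j)) + sum (λ j → when (S j) (φ (col b j)))
        ≡⟨ cong (sum (λ j → φ (col a j)) +_) (sym eq) ⟩
      sum (λ j → φ (col a j)) + sum (λ j → when (S j) (φ (col a j))) ∎)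
      where
      open ≡-Reasoning
      pointwise : ∀ j → φ (col (if S j then b else a) j) + when (S j) (φ (col a j))
                      ≡ φ (col a j) + when (S j) (φ (col b j))
      pointwise j with S j
      ... | true  = +-comm (φ (col b j)) _
      ... | false = refl

  -- Rows `u` and `v` trade their entries over `S`, which agree as multisets because the walk of
  -- colours is closed. Any other row is left alone or permuted by the transposition of `u` and `v`.
  exchange-row : ∀ {a} → Shift col u v S a a → ∀ (φ : C → ℕ) i →
    sum (λ j → φ (ex i j)) ≡ sum (λ j → φ (col i j))
  exchange-row {a} sh φ i with position u v i
  ... | at-left refl  = trans (sum-cong-≗ (λ j → cong φ (exchange-left j)))
                              (balance φ u v (+-cancelʳ-≡ (φ a) _ _ (sh φ)))
  ... | at-right refl = trans (sum-cong-≗ (λ j → cong φ (exchange-right j)))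
                              (balance φ v u (sym (+-cancelʳ-≡ (φ a) _ _ (sh φ))))
  ... | off p q = trans (sum-cong-≗ pointwise) (by-cases (S i))
    where
    pointwise : ∀ j → φ (ex i j) ≡ φ (col i (if S i then swap u v j else j))
    pointwise j with S j
    ... | true  = cong (λ k → φ (col k (if S i then swap u v j else j))) (swap-other p q)
    ... | false = refl
    by-cases : ∀ b → sum (λ j → φ (col i (if b then swap u v j else j))) ≡ sum (λ j → φ (col i j))
    by-cases true  = sum-swap (φ ∘ col i) u v
    by-cases false = refl

-- Kundu's theorem

argmax : ∀ {n} (f : Fin n → ℕ) → Fin n → ∃ λ v → ∀ i → f i ≤ f v
argmax {suc zero} f _ = zero , λ { zero → ≤-refl }
argmax {suc (suc n)} f _ with argmax (f ∘ suc) zero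
... | v , max with ≤-total (f zero) (f (suc v))
... | inj₁ p = suc v , λ { zero → p ; (suc i) → max i }
... | inj₂ p = zero , λ { zero → ≤-refl ; (suc i) → ≤-trans (max i) p }

-- The four-cycle u x y v has colours r c r c; the exchange rotates them.
module FourCycle {n} {C : Set} (col : Fin n → Fin n → C) (col-sym : ∀ i j → col i j ≡ col j i)
  {u x y v : Fin n} {r c : C}
  (ux : col u x ≡ r) (xy : col x y ≡ c) (yv : col y v ≡ r) (uv : col u v ≡ c)
  (x≢u : x ≢ u) (x≢y : x ≢ y) (v≢u : v ≢ u) (v≢y : v ≢ y) (x≢v : x ≢ v) where

  v-only S : Fin n → Bool
  v-only = insert v ∅
  S = insert x v-only

  rotated : Fin n → Fin n → C
  rotated = exchange S u y col

  Su : S u ≡ false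
  Su = insert-false v-only (≢-sym x≢u) (insert-false ∅ (≢-sym v≢u) refl)

  Sy : S y ≡ false
  Sy = insert-false v-only (≢-sym x≢y) (insert-false ∅ (≢-sym v≢y) refl)

  private
    shift-v : Shift col u y v-only c (col y v)
    shift-v = subst (λ a → Shift col u y v-only a (col y v)) uv
      (Shift-insert col {u} {y} {∅} {v} refl (Shift-∅ col u y (col y v)))

    -- Between the opposite corners `u` and `y`, the corner `x` is an arc from `r` to `c` and `v` an
    -- arc from `c` to `r`, so together they form a closed walk.
    shift-xv : Shift col u y S r r
    shift-xv = subst₂ (Shift col u y S) ux yv
      (Shift-insert col {u} {y} {v-only} {x} (insert-false ∅ x≢v refl)
        (subst (λ a → Shift col u y v-only a (col y v)) (trans (sym xy) (col-sym x y)) shift-v))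

  rotated-sym : ∀ i j → rotated i j ≡ rotated j i
  rotated-sym = exchange-sym col col-sym {u} {y} {S} Su Sy

  rotated-diag : ∀ {d} → (∀ i → col i i ≡ d) → ∀ i → rotated i i ≡ d
  rotated-diag = exchange-diag col col-sym {u} {y} {S} Su Sy

  rotated-row : ∀ (φ : C → ℕ) i → sum (λ j → φ (rotated i j)) ≡ sum (λ j → φ (col i j))
  rotated-row = exchange-row col col-sym Su Sy shift-xv

  data Lost : Fin n → Fin n → Set where
    lost-ux : Lost u x
    lost-xu : Lost x u
    lost-yv : Lost y v
    lost-vy : Lost v y

  -- The applications must know where `r` is lost, but only the colours involved where it is gained.
  data View (i j : Fin n) : Set where
    same   : rotated i j ≡ col i j → View i j
    gained : col i j ≡ c → rotated i j ≡ r → View i j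
    lost   : col i j ≡ r → rotated i j ≡ c → Lost i j → View i j

  private
    left : ∀ j → rotated u j ≡ col (if S j then y else u) j
    left = exchange-left col col-sym Su Sy

    right : ∀ j → rotated y j ≡ col (if S j then u else y) j
    right = exchange-right col col-sym Su Sy

    S-x : S x ≡ true
    S-x = insert-here x v-only

    S-v : S v ≡ true
    S-v rewrite dec-false (v ≟ x) (≢-sym x≢v) = insert-here v ∅

    S-off : ∀ {j} → j ≢ x → j ≢ v → S j ≡ false
    S-off p q = insert-false v-only p (insert-false ∅ q refl)

  rotated-uv : rotated u v ≡ r
  rotated-uv = trans (left v) (trans (cong (λ b → col (if b then y else u) v) S-v) yv)

  private
    view-u : ∀ j → View u j
    view-u j with position x v j
    ... | at-left refl = lost ux (trans (left x) (trans (cong (λ b → col (if b then y else u) x) S-x) (trans (col-sym y x) xy))) lost-ux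
    ... | at-right refl = gained uv rotated-uv
    ... | off p q = same (trans (left j) (cong (λ b → col (if b then y else u) j) (S-off p q)))

    view-y : ∀ j → View y j
    view-y j with position x v j
    ... | at-left refl = gained (trans (col-sym y x) xy) (trans (right x) (trans (cong (λ b → col (if b then u else y) x) S-x) ux))
    ... | at-right refl = lost yv (trans (right v) (trans (cong (λ b → col (if b then u else y) v) S-v) uv)) lost-yv
    ... | off p q = same (trans (right j) (cong (λ b → col (if b then u else y) j) (S-off p q)))

    lost-sym : ∀ {i j} → Lost i j → Lost j i
    lost-sym lost-ux = lost-xu
    lost-sym lost-xu = lost-ux
    lost-sym lost-yv = lost-vy
    lost-sym lost-vy = lost-yv

    flip-view : ∀ {i j} → View i j → View j i
    flip-view {i} {j} (same p)     = same (trans (rotated-sym j i) (trans p (col-sym i j)))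
    flip-view {i} {j} (gained p q) = gained (trans (col-sym j i) p) (trans (rotated-sym j i) q)
    flip-view {i} {j} (lost p q e) = lost (trans (col-sym j i) p) (trans (rotated-sym j i) q) (lost-sym e)

  view : ∀ i j → View i j
  view i j with position u y i | position u y j
  ... | at-left refl  | _             = view-u j
  ... | at-right refl | _             = view-y j
  ... | off _ _       | at-left refl  = flip-view (view-u i)
  ... | off _ _       | at-right refl = flip-view (view-y i)
  ... | off a b       | off d e       = same (exchange-off col col-sym Su Sy a b d e)

degree : ∀ {n} → Graph n → Fin n → ℕ
degree G i = sum (λ j → ind (adj G i j))

deg≡degree : ∀ {n} (G : Graph n) i → deg G i ≡ degree G i
deg≡degree G i = length-filter-tabulate (adj G i) id

excess : ∀ {n} → Graph n → Graph n → Fin n → Fin n → Bool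
excess G H i j = adj G i j ∧ not (adj H i j)

∧-trueˡ : ∀ {a b} → a ∧ b ≡ true → a ≡ true
∧-trueˡ {true} _ = refl

∧-not-falseʳ : ∀ {a b} → a ∧ not b ≡ true → b ≡ false
∧-not-falseʳ {true} {false} _ = refl

true≢false : ∀ {b} → b ≡ true → b ≡ false → ⊥
true≢false refl ()

ind-true : ∀ {b} → 0 < ind b → b ≡ true
ind-true {true} _ = refl

ind-mono : ∀ {a b} → (a ≡ true → b ≡ true) → ind a ≤ ind b
ind-mono {false} _ = z≤n
ind-mono {true} p rewrite p refl = ≤-refl

term≤sum : ∀ {m} (f : Fin m → ℕ) i → f i ≤ sum f
term≤sum f zero    = m≤m+n _ _
term≤sum f (suc i) = ≤-trans (term≤sum (f ∘ suc) i) (m≤n+m _ _)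

surplus : ∀ {n} → Graph n → Graph n → Fin n → ℕ
surplus G H i = sum (λ j → ind (excess G H i j))

-- Both sides are the degree of `i` in the union of `G` and `H`.
surplus-balance : ∀ {n} (G H : Graph n) i → surplus G H i + degree H i ≡ surplus H G i + degree G i
surplus-balance G H i = begin
  surplus G H i + degree H i ≡⟨ ∑-distrib-+ (λ j → ind (excess G H i j)) _ ⟨
  sum (λ j → ind (excess G H i j) + ind (adj H i j))
    ≡⟨ sum-cong-≗ (λ j → bits (adj G i j) (adj H i j)) ⟩
  sum (λ j → ind (excess H G i j) + ind (adj G i j)) ≡⟨ ∑-distrib-+ (λ j → ind (excess H G i j)) _ ⟩
  surplus H G i + degree G i ∎
  where
  open ≡-Reasoning
  bits : ∀ a b → ind (a ∧ not b) + ind b ≡ ind (b ∧ not a) + ind a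
  bits true  true  = refl
  bits true  false = refl
  bits false true  = refl
  bits false false = refl

-- The measure that decreases in the proof of Kundu's theorem; it vanishes exactly when `H` lies
-- inside `G`.
total : ∀ {n} → Graph n → Graph n → ℕ
total H G = sum (λ i → surplus H G i)

total-< : ∀ {n} {G H G′ H′ : Graph n} → (∀ i j → excess H′ G′ i j ≡ true → excess H G i j ≡ true) →
  ∀ u v → excess H G u v ≡ true → excess H′ G′ u v ≡ false → total H′ G′ < total H G
total-< {n} {G} {H} {G′} {H′} imp u v e e′ = sum-mono-<
  (λ i → sum-mono (λ j → ind-mono (imp i j))) u
  (sum-mono-< (λ j → ind-mono (imp u j)) v strict)
  where
  strict : ind (excess H′ G′ u v) < ind (excess H G u v)
  strict rewrite e | e′ = ≤-refl

module _ {n} (G : Graph n) {u x y v : Fin n} {r c : Bool}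
  (ux : adj G u x ≡ r) (xy : adj G x y ≡ c) (yv : adj G y v ≡ r) (uv : adj G u v ≡ c)
  (x≢u : x ≢ u) (x≢y : x ≢ y) (v≢u : v ≢ u) (v≢y : v ≢ y) (x≢v : x ≢ v) where

  open FourCycle (adj G) (Graph.sym G) ux xy yv uv x≢u x≢y v≢u v≢y x≢v

  rotate : Graph n
  rotate = record { adj = rotated ; sym = rotated-sym ; irrefl = rotated-diag (irrefl G) }

  rotate-degree : ∀ i → degree rotate i ≡ degree G i
  rotate-degree = rotated-row ind

∧-not : ∀ {a b} → a ≡ true → b ≡ false → a ∧ not b ≡ true
∧-not refl refl = refl

-- If v has the most edges of H outside G and uv is one of them, then for an edge ux of G outside H
-- either a rotation of G or of H brings them closer, or the edges of G outside H at v extend to x,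
-- contradicting the choice of v.
module _ {n k : ℕ} (k≥1 : 1 ≤ k) where

  record Step (G H : Graph n) : Set where
    field
      G′ H′   : Graph n
      degree-G : ∀ i → degree G′ i ≡ degree G i
      degree-H : ∀ i → degree H′ i ≡ degree H i
      closer  : total H′ G′ < total H G

  module Towards (G H : Graph n) (diff : ∀ i → degree G i ≡ degree H i + k) where

    R X : Fin n → Fin n → Bool
    R = excess G H
    X = excess H G

    R-sym : ∀ i j → R i j ≡ R j i
    R-sym i j = cong₂ (λ a b → a ∧ not b) (Graph.sym G i j) (Graph.sym H i j)

    X-sym : ∀ i j → X i j ≡ X j i
    X-sym i j = cong₂ (λ a b → a ∧ not b) (Graph.sym H i j) (Graph.sym G i j)

    -- Common edges cancel. Hence a vertex that is maximal for `X` is maximal for `R`, and, as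
    -- `k ≥ 1`, every vertex has an edge in `R`.
    R≡X+k : ∀ i → surplus G H i ≡ surplus H G i + k
    R≡X+k i = +-cancelʳ-≡ (degree H i) _ _ (begin
      surplus G H i + degree H i ≡⟨ surplus-balance G H i ⟩
      surplus H G i + degree G i ≡⟨ cong (surplus H G i +_) (trans (diff i) (+-comm (degree H i) k)) ⟩
      surplus H G i + (k + degree H i) ≡⟨ +-assoc (surplus H G i) k _ ⟨
      surplus H G i + k + degree H i ∎)
      where open ≡-Reasoning

    module _ {v u x : Fin n} (max : ∀ i → surplus H G i ≤ surplus H G v)
             (Xvu : X v u ≡ true) (Rux : R u x ≡ true) where

      irreflexive : ∀ (A : Graph n) {i j} → adj A i j ≡ true → i ≢ j
      irreflexive A {i} p refl = true≢false p (irrefl A i)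

      Huv : adj H u v ≡ true
      Huv = trans (Graph.sym H u v) (∧-trueˡ Xvu)

      Guv : adj G u v ≡ false
      Guv = trans (Graph.sym G u v) (∧-not-falseʳ Xvu)

      Gux : adj G u x ≡ true
      Gux = ∧-trueˡ Rux

      Hux : adj H u x ≡ false
      Hux = ∧-not-falseʳ Rux

      x≢u : x ≢ u
      x≢u = ≢-sym (irreflexive G Gux)

      v≢u : v ≢ u
      v≢u = ≢-sym (irreflexive H Huv)

      x≢v : x ≢ v
      x≢v x≡v = true≢false Gux (subst (λ z → adj G u z ≡ false) (sym x≡v) Guv)

      -- If `xy` is outside `G`, the four-cycle alternates in `G` and rotating it puts `uv` into
      -- `G`. Otherwise `xy` is in `H` too, the cycle alternates in `H` and rotating it takes `uv`
      -- out of `H`. The sides lost by `G` are not in `H`, and those gained by `H` are in `G`, so no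
      -- new edge of `H` outside `G` arises.
      with-y : ∀ y → R v y ≡ true → y ≢ x → R x y ≡ false → Step G H
      with-y y Rvy y≢x Rxy with adj G x y in Gxy
      ... | false = record
        { G′ = rotate G Gux Gxy Gyv Guv x≢u (≢-sym y≢x) v≢u v≢y x≢v ; H′ = H
        ; degree-G = rotate-degree G Gux Gxy Gyv Guv x≢u (≢-sym y≢x) v≢u v≢y x≢v ; degree-H = λ _ → refl
        ; closer = total-< {G = G} {H} {rotate G Gux Gxy Gyv Guv x≢u (≢-sym y≢x) v≢u v≢y x≢v} {H} imp u v (trans (X-sym u v) Xvu) (cong₂ (λ a b → a ∧ not b) Huv rotated-uv) }
        where
        Gyv = trans (Graph.sym G y v) (∧-trueˡ Rvy)
        v≢y = irreflexive G (∧-trueˡ Rvy)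
        Hyv = trans (Graph.sym H y v) (∧-not-falseʳ Rvy)
        open FourCycle (adj G) (Graph.sym G) Gux Gxy Gyv Guv x≢u (≢-sym y≢x) v≢u v≢y x≢v
        absent : ∀ {i j} → Lost i j → adj H i j ≡ false
        absent lost-ux = Hux
        absent lost-xu = trans (Graph.sym H x u) Hux
        absent lost-yv = Hyv
        absent lost-vy = ∧-not-falseʳ Rvy
        imp : ∀ i j → adj H i j ∧ not (rotated i j) ≡ true → X i j ≡ true
        imp i j p with view i j
        ... | same q     = trans (cong (λ b → adj H i j ∧ not b) (sym q)) p
        ... | gained q _ = ∧-not (∧-trueˡ p) q
        ... | lost _ _ e = ⊥-elim (true≢false (∧-trueˡ p) (absent e))
      ... | true = record
        { G′ = G ; H′ = rotate H Hux Hxy Hyv Huv x≢u (≢-sym y≢x) v≢u v≢y x≢v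
        ; degree-G = λ _ → refl ; degree-H = rotate-degree H Hux Hxy Hyv Huv x≢u (≢-sym y≢x) v≢u v≢y x≢v
        ; closer = total-< {G = G} {H} {G} {rotate H Hux Hxy Hyv Huv x≢u (≢-sym y≢x) v≢u v≢y x≢v} imp u v (trans (X-sym u v) Xvu) (cong (_∧ not (adj G u v)) rotated-uv) }
        where
        not-false : ∀ {b} → not b ≡ false → b ≡ true
        not-false {true} _ = refl
        Hxy : adj H x y ≡ true
        Hxy = not-false Rxy
        v≢y = irreflexive G (∧-trueˡ Rvy)
        Hyv = trans (Graph.sym H y v) (∧-not-falseʳ Rvy)
        Gyv = trans (Graph.sym G y v) (∧-trueˡ Rvy)
        open FourCycle (adj H) (Graph.sym H) Hux Hxy Hyv Huv x≢u (≢-sym y≢x) v≢u v≢y x≢v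
        present : ∀ {i j} → Lost i j → adj G i j ≡ true
        present lost-ux = Gux
        present lost-xu = trans (Graph.sym G x u) Gux
        present lost-yv = Gyv
        present lost-vy = ∧-trueˡ Rvy
        imp : ∀ i j → rotated i j ∧ not (adj G i j) ≡ true → X i j ≡ true
        imp i j p with view i j
        ... | same q     = trans (cong (_∧ not (adj G i j)) (sym q)) p
        ... | gained _ q = ⊥-elim (true≢false (∧-trueˡ p) q)
        ... | lost _ _ e = ⊥-elim (true≢false (present e) (∧-not-falseʳ p))

      step : Step G H
      step with any? (λ y → (R v y Bool.≟ true) ×-dec ¬? (y ≟ x) ×-dec (R x y Bool.≟ false))
      ... | yes (y , p , q , r) = with-y y p q r
      ... | no none = ⊥-elim (<⇒≱ more (≤-trans (≤-reflexive (R≡X+k x))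
                        (≤-trans (+-monoˡ-≤ k (max x)) (≤-reflexive (sym (R≡X+k v))))))
        where
        extends : ∀ z → z ≢ v → z ≢ x → R v z ≡ true → R x z ≡ true
        extends z _ z≢x p with R x z in eq
        ... | true  = refl
        ... | false = ⊥-elim (none (z , p , z≢x , eq))
        Rvu : R v u ≡ false
        Rvu = trans (R-sym v u) (cong (_∧ not (adj H u v)) Guv)
        diag : ∀ i → R i i ≡ false
        diag i = cong (_∧ not (adj H i i)) (irrefl G i)
        more : surplus G H v < surplus G H x
        -- The strict inequality comes from `u`: `xu` is in `R` while `vu` is not.
        more = sum-row-< v x u
          (cong ind (trans (diag v) (sym (diag x))))
          (cong ind (R-sym v x))
          (λ z p q → ind-mono (extends z p q)) (≢-sym v≢u) (≢-sym x≢u)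
          (subst₂ (λ a b → ind a < ind b) (sym Rvu) (sym (trans (R-sym x u) Rux)) ≤-refl)

    step-exists : ∀ {i j} → X i j ≡ true → Step G H
    step-exists {i} {j} e =
      let v , max = argmax (surplus H G) i
          u , vu  = sum-positive _ (≤-trans (≤-trans (subst (λ b → 1 ≤ ind b) (sym e) ≤-refl)
                      (term≤sum (λ j → ind (X i j)) j)) (max i))
          x , ux  = sum-positive (λ j → ind (R u j))
                      (subst (0 <_) (sym (R≡X+k u)) (≤-trans k≥1 (m≤n+m k _)))
      in step max (ind-true vu) (ind-true ux)

  record Nested (G H : Graph n) : Set where
    field
      G′ H′     : Graph n
      degree-G : ∀ i → degree G′ i ≡ degree G i
      degree-H : ∀ i → degree H′ i ≡ degree H i
      nested   : ∀ i j → excess H′ G′ i j ≡ false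

  kundu′ : ∀ m (G H : Graph n) → total H G ≤ m → (∀ i → degree G i ≡ degree H i + k) → Nested G H
  kundu′ m G H t≤m diff with any? (λ i → any? (λ j → excess H G i j Bool.≟ true))
  ... | no none = record { G′ = G ; H′ = H ; degree-G = λ _ → refl ; degree-H = λ _ → refl ; nested = nested }
    where
    nested : ∀ i j → excess H G i j ≡ false
    nested i j with excess H G i j in eq
    ... | true  = ⊥-elim (none (i , j , eq))
    ... | false = refl
  kundu′ zero G H t≤m diff | yes (i , j , e) = ⊥-elim (n≮0 (<-≤-trans (Step.closer (Towards.step-exists G H diff e)) t≤m))
  kundu′ (suc m) G H t≤m diff | yes (i , j , e) = record
    { G′ = N.G′ ; H′ = N.H′
    ; degree-G = λ i → trans (N.degree-G i) (S.degree-G i)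
    ; degree-H = λ i → trans (N.degree-H i) (S.degree-H i)
    ; nested = N.nested }
    where
    module S = Step (Towards.step-exists G H diff e)
    module N = Nested (kundu′ m S.G′ S.H′ (s≤s⁻¹ (≤-trans S.closer t≤m))
      (λ i → trans (S.degree-G i) (trans (diff i) (cong (_+ k) (sym (S.degree-H i))))))

  kundu : (G H : Graph n) → (∀ i → degree G i ≡ degree H i + k) → Nested G H
  kundu G H = kundu′ (total H G) G H ≤-refl

-- Multi-switches and Hall's theorem for regular bipartite graphs

sum-one : ∀ n → sum {n} (λ _ → 1) ≡ n
sum-one zero    = refl
sum-one (suc n) = cong suc (sum-one n)

∨-introˡ : ∀ {a b} → a ≡ true → a ∨ b ≡ true
∨-introˡ refl = refl

∨-introʳ : ∀ {a b} → b ≡ true → a ∨ b ≡ true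
∨-introʳ {true}  refl = refl
∨-introʳ {false} refl = refl

-- Strict growth in each of `suc m` steps would produce more than `m` elements. This ends both the
-- search for walks of colours and the search for alternating paths.
stabilise : ∀ {m} (L : ℕ → Fin m → Bool) → (∀ i c → L i c ≡ true → L (suc i) c ≡ true) →
  ∃ λ i → ∀ c → L (suc i) c ≡ true → L i c ≡ true
stabilise {m} L mono with grow (suc m)
  where
  Stable : Set
  Stable = ∃ λ i → ∀ c → L (suc i) c ≡ true → L i c ≡ true
  grow : ∀ i → Stable ⊎ i ≤ sum (ind ∘ L i)
  grow zero = inj₂ z≤n
  grow (suc i) with grow i
  ... | inj₁ s = inj₁ s
  ... | inj₂ p with any? (λ c → (L (suc i) c Bool.≟ true) ×-dec (L i c Bool.≟ false))
  ...   | yes (c , q , r) = inj₂ (<-≤-trans (s≤s p) (sum-mono-< (λ c → ind-mono (mono i c)) c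
                              (subst₂ (λ a b → ind a < ind b) (sym r) (sym q) ≤-refl)))
  ...   | no none = inj₁ (i , λ c q → closed c q)
    where
    closed : ∀ c → L (suc i) c ≡ true → L i c ≡ true
    closed c q with L i c in eq
    ... | true  = refl
    ... | false = ⊥-elim (none (c , q , eq))
... | inj₁ s = s
... | inj₂ p = ⊥-elim (<⇒≱ p (≤-trans (sum-mono (λ c → ind≤1 (L (suc m) c))) (≤-reflexive (sum-one m))))
  where
  ind≤1 : ∀ b → ind b ≤ 1
  ind≤1 true  = ≤-refl
  ind≤1 false = z≤n

count : ∀ {n m} → (Fin n → Fin m) → Fin m → ℕ
count row c = sum (λ j → ind (does (c ≟ row j)))

sum-by-colour : ∀ {n m} (row : Fin n → Fin m) (φ : Fin m → ℕ) →
  sum (λ j → φ (row j)) ≡ sum (λ c → sum (λ j → when (does (c ≟ row j)) (φ c)))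
sum-by-colour row φ = trans (sum-cong-≗ (λ j → sym (sum-single φ (row j)))) (∑-comm (λ j c → when (does (c ≟ row j)) (φ c)))

-- Each i with colours a = ui and b = vi is an arc a → b of a digraph on the colours. A closed walk using
-- the arc r → w at x allows the exchange; otherwise the colours from which r can be reached form a set
-- containing r but not w, seen more often from u than from v.
module MultiSwitch {n m} (col : Fin n → Fin n → Fin m) (col-sym : ∀ i j → col i j ≡ col j i)
  {diag : Fin m} (col-diag : ∀ i → col i i ≡ diag)
  {u v x : Fin n} {r w : Fin m} (ux : col u x ≡ r) (vx : col v x ≡ w)
  (x≢u : x ≢ u) (x≢v : x ≢ v) (degrees : ∀ c → c ≢ w → count (col u) c ≤ count (col v) c) where

  -- By `only-x`, the exchange takes no edge of colour `r` away from `u` except `ux`; the red edges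
  -- needed later survive for this reason.
  record Switch : Set where
    field
      S        : Fin n → Bool
      Su       : S u ≡ false
      Sv       : S v ≡ false
      balanced : Shift col u v S r r
      Sx       : S x ≡ true
      only-x   : ∀ z → S z ≡ true → col u z ≡ r → z ≡ x

  private
    Arc : (Fin m → Bool) → Fin m → Fin n → Set
    Arc L c z = z ≢ u × z ≢ v × col u z ≡ c × L (col v z) ≡ true

    arc? : ∀ L c → Dec (∃ (Arc L c))
    arc? L c = any? (λ z → ¬? (z ≟ u) ×-dec ¬? (z ≟ v) ×-dec (col u z ≟ c) ×-dec (L (col v z) Bool.≟ true))

    -- Backward search: the colours from which at most `i` arcs lead to `r`.
    L : ℕ → Fin m → Bool
    L zero    c = does (c ≟ r)
    L (suc i) c = L i c ∨ does (arc? (L i) c)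

    L-r : ∀ i → L i r ≡ true
    L-r zero    = dec-true (r ≟ r) refl
    L-r (suc i) = ∨-introˡ (L-r i)

    record Path (i : ℕ) (c : Fin m) : Set where
      field
        S      : Fin n → Bool
        Su     : S u ≡ false
        Sv     : S v ≡ false
        shifted : Shift col u v S c r
        within : ∀ z → S z ≡ true → L i (col u z) ≡ true
        avoids : ∀ z → S z ≡ true → col u z ≢ r

    -- A colour is treated at the first stage that contains it. Its arc `z` then starts outside
    -- `L i`, whereas all further arcs start inside, so `z` is new to the walk; and no arc starts at
    -- `r`, which is in every stage.
    path : ∀ i c → L i c ≡ true → Path i c
    path zero c p with c ≟ r
    ... | yes refl = record { S = ∅ ; Su = refl ; Sv = refl ; shifted = Shift-∅ col u v r ; within = λ _ () ; avoids = λ _ () }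
    path (suc i) c p with L i c in eq
    ... | true = record { S = P.S ; Su = P.Su ; Sv = P.Sv ; shifted = P.shifted ; within = λ z q → ∨-introˡ (P.within z q) ; avoids = P.avoids }
      where module P = Path (path i c eq)
    ... | false with arc? (L i) c
    ...   | yes (z , z≢u , z≢v , refl , q) = record
      { S = insert z P.S ; Su = insert-false P.S (≢-sym z≢u) P.Su ; Sv = insert-false P.S (≢-sym z≢v) P.Sv
      ; shifted = Shift-insert col {u} {v} {P.S} {z} z∉S P.shifted ; within = within ; avoids = avoids }
      where
      module P = Path (path i (col v z) q)
      z∉S : P.S z ≡ false
      z∉S with P.S z in s
      ... | false = refl
      ... | true  with () ← trans (sym eq) (P.within z s)
      within : ∀ y → insert z P.S y ≡ true → L (suc i) (col u y) ≡ true
      within y s with insert-elim P.S s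
      ... | inj₁ refl = ∨-introʳ (dec-true (arc? (L i) (col u z)) (z , z≢u , z≢v , refl , q))
      ... | inj₂ t    = ∨-introˡ (P.within y t)
      avoids : ∀ y → insert z P.S y ≡ true → col u y ≢ r
      avoids y s with insert-elim P.S s
      ... | inj₁ refl = λ uz → true≢false (L-r i) (subst (λ c → L i c ≡ false) uz eq)
      ... | inj₂ t    = P.avoids y t

  switch : Switch
  switch with stabilise L (λ i c → ∨-introˡ)
  ... | i , closed with L i w in eq
  ...   | true = record
    { S = insert x P.S ; Su = insert-false P.S (≢-sym x≢u) P.Su ; Sv = insert-false P.S (≢-sym x≢v) P.Sv
    ; balanced = subst (λ a → Shift col u v (insert x P.S) a r) ux
        (Shift-insert col {u} {v} {P.S} {x} x∉S (subst (λ a → Shift col u v P.S a r) (sym vx) P.shifted))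
    ; Sx = insert-here x P.S ; only-x = only }
    where
    module P = Path (path i w eq)
    x∉S : P.S x ≡ false
    x∉S with P.S x in s
    ... | false = refl
    ... | true  = ⊥-elim (P.avoids x s ux)
    only : ∀ z → insert x P.S z ≡ true → col u z ≡ r → z ≡ x
    only z s uz with insert-elim P.S s
    ... | inj₁ p = p
    ... | inj₂ t = ⊥-elim (P.avoids z t uz)
  -- Since `w` is outside the stable set, `degrees` applies to each colour in it and bounds the
  -- number of entries seen from `u` by the number seen from `v`.
  ...   | false = ⊥-elim (<⇒≱ seen (subst₂ _≤_ (sym (sum-by-colour (col u) ψ)) (sym (sum-by-colour (col v) ψ)) (sum-mono compare)))
    where
    ψ : Fin m → ℕ
    ψ c = ind (L i c)
    seen : sum (λ z → ψ (col v z)) < sum (λ z → ψ (col u z))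
    seen = sum-row-< v u x (cong ψ (trans (col-diag v) (sym (col-diag u)))) (cong ψ (col-sym v u))
      (λ z z≢v z≢u → ind-mono (λ q → closed (col u z) (∨-introʳ (dec-true (arc? (L i) (col u z)) (z , z≢u , z≢v , refl , q)))))
      x≢v x≢u (subst₂ (λ a b → ind a < ind b) (sym (trans (cong (L i) vx) eq)) (sym (trans (cong (L i) ux) (L-r i))) ≤-refl)
    compare : ∀ c → sum (λ j → when (does (c ≟ col u j)) (ψ c)) ≤ sum (λ j → when (does (c ≟ col v j)) (ψ c))
    compare c with L i c in Lc
    ... | true  = degrees c (λ { refl → true≢false Lc eq })
    ... | false = sum-mono (λ j → ≤-trans (when-0 (does (c ≟ col u j))) z≤n)
      where
      when-0 : ∀ b → when b 0 ≤ 0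
      when-0 true  = z≤n
      when-0 false = z≤n

-- Augmenting paths in regular bipartite graphs

module Hall {n} (A : Fin n → Fin n → Bool) {d : ℕ} (d≥1 : 1 ≤ d)
  (rows : ∀ x → sum (λ y → ind (A x y)) ≡ d) (columns : ∀ y → sum (λ x → ind (A x y)) ≡ d) where

  -- A partial matching is stored on the columns: `g y` is the row matched to `y`, if there is one.
  record Matching (g : Fin n → Maybe (Fin n)) : Set where
    field
      edge : ∀ {x y} → g y ≡ just x → A x y ≡ true
      inj  : ∀ {x y z} → g y ≡ just x → g z ≡ just x → y ≡ z
  open Matching

  Matched : (Fin n → Maybe (Fin n)) → Fin n → Set
  Matched g x = ∃ λ y → g y ≡ just x

  _[_≔_] : (Fin n → Maybe (Fin n)) → Fin n → Maybe (Fin n) → Fin n → Maybe (Fin n)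
  (g [ y ≔ a ]) z = if does (z ≟ y) then a else g z

  set-here : ∀ g y a → (g [ y ≔ a ]) y ≡ a
  set-here g y a rewrite dec-true (y ≟ y) refl = refl

  set-other : ∀ g {y z} a → z ≢ y → (g [ y ≔ a ]) z ≡ g z
  set-other g {y} {z} a z≢y rewrite dec-false (z ≟ y) z≢y = refl

  remove-matching : ∀ {g} y → Matching g → Matching (g [ y ≔ nothing ])
  remove-matching {g} y M = record { edge = λ p → edge M (old p) ; inj = λ p q → inj M (old p) (old q) }
    where
    old : ∀ {x z} → (g [ y ≔ nothing ]) z ≡ just x → g z ≡ just x
    old {x} {z} p with z ≟ y
    ... | no _ = p

  add-matching : ∀ {g x y} → Matching g → A x y ≡ true → ¬ Matched g x → Matching (g [ y ≔ just x ])
  add-matching {g} {x} {y} M Axy new = record { edge = e ; inj = i }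
    where
    e : ∀ {a b} → (g [ y ≔ just x ]) b ≡ just a → A a b ≡ true
    e {a} {b} p with b ≟ y
    ... | yes refl with refl ← p = Axy
    ... | no _ = edge M p
    i : ∀ {a b c} → (g [ y ≔ just x ]) b ≡ just a → (g [ y ≔ just x ]) c ≡ just a → b ≡ c
    i {a} {b} {c} p q with b ≟ y | c ≟ y
    ... | yes refl | yes refl = refl
    ... | yes refl | no _ with refl ← p = ⊥-elim (new (c , q))
    ... | no _ | yes refl with refl ← q = ⊥-elim (new (b , p))
    ... | no _ | no _ = inj M p q

  module Augment (g : Fin n → Maybe (Fin n)) (M : Matching g) where

    onward? : ∀ (Y : Fin n → Bool) x → Dec (∃ λ y → A x y ≡ true × Y y ≡ true)
    onward? Y x = any? (λ y → (A x y Bool.≟ true) ×-dec (Y y Bool.≟ true))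

    leads : (Fin n → Bool) → Maybe (Fin n) → Bool
    leads Y nothing  = true
    leads Y (just x) = does (onward? Y x)

    -- Backward search: the columns from which an alternating path through at most `i` columns ends
    -- at an unmatched column.
    Y : ℕ → Fin n → Bool
    Y zero    y = false
    Y (suc i) y = Y i y ∨ leads (Y i) (g y)

    -- `same` serves the induction: a column that enters at the next stage keeps its row while an
    -- earlier column is being freed.
    record Freed (i : ℕ) (y : Fin n) : Set where
      field
        g′       : Fin n → Maybe (Fin n)
        matching : Matching g′
        free     : g′ y ≡ nothing
        same     : ∀ z → Y i z ≡ false → g′ z ≡ g z
        keeps    : ∀ x → Matched g x → Matched g′ x
        no-new   : ∀ x → Matched g′ x → Matched g x

    ∨-falseˡ : ∀ {a b} → a ∨ b ≡ false → a ≡ false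
    ∨-falseˡ {false} _ = refl

    -- Once `y′` has been freed, the row matched to `y` moves on to `y′`, and this leaves `y`
    -- unmatched.
    freed : ∀ i y → Y i y ≡ true → Freed i y
    freed (suc i) y p with Y i y in eq
    ... | true = record { g′ = F.g′ ; matching = F.matching ; free = F.free ; same = λ z q → F.same z (∨-falseˡ q) ; keeps = F.keeps ; no-new = F.no-new }
      where module F = Freed (freed i y eq)
    ... | false with g y in gy
    ...   | nothing = record { g′ = g ; matching = M ; free = gy ; same = λ _ _ → refl ; keeps = λ _ m → m ; no-new = λ _ m → m }
    ...   | just x with onward? (Y i) x
    ...     | yes (y′ , Axy′ , q) = record
      { g′ = g₂ ; matching = add-matching (remove-matching y F.matching) Axy′ gone
      ; free = trans (set-other g₁ (just x) y≢y′) (set-here F.g′ y nothing)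
      ; same = same ; keeps = keeps ; no-new = no-new }
      where
      module F = Freed (freed i y′ q)
      g₁ = F.g′ [ y ≔ nothing ]
      g₂ = g₁ [ y′ ≔ just x ]
      y≢y′ : y ≢ y′
      y≢y′ refl with () ← trans (sym eq) q
      F-y : F.g′ y ≡ just x
      F-y = trans (F.same y eq) gy
      gone : ¬ Matched g₁ x
      gone (z , r) with z ≟ y
      ... | no z≢y = z≢y (inj F.matching r F-y)
      same : ∀ z → Y (suc i) z ≡ false → g₂ z ≡ g z
      same z r with z ≟ y′ | z ≟ y
      ... | yes refl | _ with () ← trans (sym r) (∨-introˡ q)
      ... | no _ | yes refl with () ← trans (sym r) (∨-introʳ (trans (cong (leads (Y i)) gy) (dec-true (onward? (Y i) x) (y′ , Axy′ , q))))
      ... | no _ | no _ = F.same z (∨-falseˡ r)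
      keeps : ∀ a → Matched g a → Matched g₂ a
      keeps a m with F.keeps a m
      ... | z , r with z ≟ y
      ...   | yes refl with refl ← trans (sym F-y) r = y′ , set-here g₁ y′ (just a)
      ...   | no z≢y = z , trans (set-other g₁ (just x) z≢y′) (trans (set-other F.g′ nothing z≢y) r)
        where
        z≢y′ : z ≢ y′
        z≢y′ refl with () ← trans (sym F.free) r
      no-new : ∀ a → Matched g₂ a → Matched g a
      no-new a (z , r) with z ≟ y′
      ... | yes refl with refl ← r = y , gy
      ... | no _ with z ≟ y
      ...   | no _ = F.no-new a (z , r)

    module _ {x₀ : Fin n} (unmatched : ¬ Matched g x₀) where

      record Extended : Set where
        field
          g′       : Fin n → Maybe (Fin n)
          matching : Matching g′
          covers   : Matched g′ x₀
          keeps    : ∀ x → Matched g x → Matched g′ x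

      hits : Maybe (Fin n) → Fin n → Bool
      hits nothing  x = false
      hits (just z) x = does (x ≟ z)

      hits-true : ∀ a {x} → hits a x ≡ true → a ≡ just x
      hits-true (just z) {x} p with x ≟ z
      ... | yes refl = refl

      -- All edges at x₀ and at the rows matched to columns in U end in U: one row too many.
      stuck : ∀ (U : Fin n → Bool) → (∀ y → U y ≡ true → ∃ λ x → g y ≡ just x × (∀ z → A x z ≡ true → U z ≡ true)) →
        (∀ z → A x₀ z ≡ true → U z ≡ true) → ⊥
      stuck U closed start = <⇒≱ (m<n+m (sum (λ y → when (U y) d)) d≥1)
        (subst₂ _≤_ left right (sum-mono row))
        where
        hit : Fin n → Fin n → ℕ
        hit x y = when (U y ∧ hits (g y) x) d
        rowU : Fin n → ℕ
        rowU x = sum (λ y → when (U y) (ind (A x y)))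
        full : ∀ x → (∀ z → A x z ≡ true → U z ≡ true) → d ≤ rowU x
        full x c = ≤-trans (≤-reflexive (sym (rows x))) (sum-mono pointwise)
          where
          pointwise : ∀ z → ind (A x z) ≤ when (U z) (ind (A x z))
          pointwise z with A x z in Axz
          ... | false = z≤n
          ... | true rewrite c z Axz = ≤-refl
        and-true : ∀ {a b} → a ∧ b ≡ true → a ≡ true × b ≡ true
        and-true {true} p = refl , p
        -- A row is charged `d` if it is `x₀` or is matched to a column in `U`; all its `d` edges
        -- then end in `U`. It is never charged twice, as `x₀` is unmatched and no row is matched to
        -- two columns.
        row : ∀ x → when (does (x ≟ x₀)) d + sum (hit x) ≤ rowU x
        row x with any? (λ y → (U y ∧ hits (g y) x) Bool.≟ true)
        ... | no none = ≤-trans (+-monoʳ-≤ (when (does (x ≟ x₀)) d) (≤-trans (sum-mono zeros) (≤-reflexive (sum-replicate-zero n)))) (≤-trans (≤-reflexive (+-identityʳ _)) (first (x ≟ x₀)))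
          where
          zeros : ∀ y → hit x y ≤ 0
          zeros y with U y ∧ hits (g y) x in eq
          ... | true  = ⊥-elim (none (y , eq))
          ... | false = z≤n
          first : ∀ (e : Dec (x ≡ x₀)) → when (does e) d ≤ rowU x
          first (yes refl) = full x start
          first (no _)     = z≤n
        ... | yes (y , q) with and-true {U y} q
        ...   | Uy , h with closed y Uy | hits-true (g y) h
        ...     | x′ , gy , c | gy′ with refl ← trans (sym gy) gy′ =
          subst (λ b → when b d + sum (hit x) ≤ rowU x) (sym (dec-false (x ≟ x₀) (λ { refl → unmatched (y , gy) })))
            (≤-trans (sum-mono single) (≤-trans (≤-reflexive (sum-single (λ _ → d) y)) (full x c)))
          where
          single : ∀ z → hit x z ≤ when (does (z ≟ y)) d
          single z with U z ∧ hits (g z) x in eq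
          ... | false = z≤n
          ... | true with refl ← inj M (hits-true (g z) (proj₂ (and-true {U z} eq))) gy
                rewrite dec-true (z ≟ z) refl = ≤-refl
        left : sum (λ x → when (does (x ≟ x₀)) d + sum (hit x)) ≡ d + sum (λ y → when (U y) d)
        left = trans (∑-distrib-+ (λ x → when (does (x ≟ x₀)) d) (λ x → sum (hit x)))
          (cong₂ _+_ (sum-single (λ _ → d) x₀) (trans (∑-comm hit) (sum-cong-≗ column)))
          where
          column : ∀ y → sum (λ x → hit x y) ≡ when (U y) d
          column y with U y in Uy
          ... | false = sum-replicate-zero n
          ... | true with x , gy , _ ← closed y Uy rewrite gy = sum-single (λ _ → d) x
        right : sum rowU ≡ sum (λ y → when (U y) d)
        right = trans (∑-comm (λ x y → when (U y) (ind (A x y)))) (sum-cong-≗ column)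
          where
          column : ∀ y → sum (λ x → when (U y) (ind (A x y))) ≡ when (U y) d
          column y with U y
          ... | true  = columns y
          ... | false = sum-replicate-zero n

      extend : Extended
      extend with stabilise Y (λ i c → ∨-introˡ)
      ... | i , closed with onward? (Y i) x₀
      ...   | yes (y , Ax₀y , q) = record
        { g′ = F.g′ [ y ≔ just x₀ ] ; matching = add-matching F.matching Ax₀y (λ m → unmatched (F.no-new x₀ m))
        ; covers = y , set-here F.g′ y (just x₀)
        ; keeps = λ x m → let z , r = F.keeps x m in
            z , trans (set-other F.g′ (just x₀) (λ z≡y → nothing≢just (trans (sym F.free) (trans (cong F.g′ (sym z≡y)) r)))) r }
        where
        module F = Freed (freed i y q)
        nothing≢just : ∀ {x : Fin n} → nothing ≢ just x
        nothing≢just ()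
      -- Here `U` consists of the columns that cannot be freed; as the search is stable, edges from
      -- their rows stay in `U`.
      ...   | no none = ⊥-elim (stuck (not ∘ Y i) matched start)
        where
        not-true : ∀ {b} → not b ≡ true → b ≡ false
        not-true {false} _ = refl
        start : ∀ z → A x₀ z ≡ true → not (Y i z) ≡ true
        start z a with Y i z in eq
        ... | true  = ⊥-elim (none (z , a , eq))
        ... | false = refl
        matched : ∀ y → not (Y i y) ≡ true → ∃ λ x → g y ≡ just x × (∀ z → A x z ≡ true → not (Y i z) ≡ true)
        matched y p with g y in gy
        ... | nothing with () ← trans (sym (not-true p)) (closed y (∨-introʳ (cong (leads (Y i)) gy)))
        ... | just x = x , refl , avoid
          where
          avoid : ∀ z → A x z ≡ true → not (Y i z) ≡ true
          avoid z a with Y i z in eq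
          ... | false = refl
          ... | true with () ← trans (sym (not-true p)) (closed y (∨-introʳ (trans (cong (leads (Y i)) gy) (dec-true (onward? (Y i) x) (z , a , eq)))))

  matching-of : ∀ (xs : List (Fin n)) → ∃ λ g → Matching g × (∀ {x} → x ∈ xs → Matched g x)
  matching-of [] = (λ _ → nothing) , record { edge = λ () ; inj = λ () } , λ ()
  matching-of (x ∷ xs) with matching-of xs
  ... | g , M , cover with any? (λ y → matches? (g y))
    where
    matches? : ∀ a → Dec (a ≡ just x)
    matches? a = ≡-dec _≟_ a (just x)
  ...   | yes m = g , M , λ { (here refl) → m ; (there p) → cover p }
  ...   | no ¬m = E.g′ , E.matching , λ { (here refl) → E.covers ; (there p) → E.keeps _ (cover p) }
    where module E = Augment.Extended (Augment.extend g M ¬m)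

  -- Rows and columns share the index set `Fin n`, so a matching of all rows is an injective
  -- self-map. For the adjacency matrix of a graph its orbits are edges and cycles.
  permutation : ∃ λ (π : Fin n → Fin n) → (∀ x → A x (π x) ≡ true) × (∀ {x y} → π x ≡ π y → x ≡ y)
  permutation with matching-of (allFin n)
  ... | g , M , cover = (λ x → proj₁ (cover (∈-allFin x))) , (λ x → edge M (proj₂ (cover (∈-allFin x)))) ,
    λ {x} {y} e → just-injective (trans (sym (proj₂ (cover (∈-allFin x)))) (trans (cong g e) (proj₂ (cover (∈-allFin y)))))

-- Edges and odd cycles

Even : ℕ → Set
Even zero          = ⊤
Even (suc zero)    = ⊥
Even (suc (suc n)) = Even n

even-or-odd : ∀ n → Even n ⊎ Even (suc n)
even-or-odd zero    = inj₁ tt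
even-or-odd (suc n) with even-or-odd n
... | inj₁ p = inj₂ p
... | inj₂ p = inj₁ p

even+even : ∀ m n → Even m → Even (m + n) → Even n
even+even zero          n _ q = q
even+even (suc (suc m)) n p q = even+even m n p q

unique-resp-↭ : ∀ {A : Set} {xs ys : List A} → xs ↭ ys → Unique xs → Unique ys
unique-resp-↭ {A} p = Setoid↭.Unique-resp-↭ (setoid A) (↭⇒↭ₛ p)

unique-disjoint : ∀ {A : Set} (xs : List A) {ys z} → Unique (xs ++ ys) → z ∈ xs → z ∈ ys → ⊥
unique-disjoint (x ∷ xs) (a ∷ _) (here refl) q = All.lookup a (∈-++⁺ʳ xs q) refl
unique-disjoint (x ∷ xs) (_ ∷ u) (there p)   q = unique-disjoint xs u p q

unique-++ʳ : ∀ {A : Set} (xs : List A) {ys} → Unique (xs ++ ys) → Unique ys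
unique-++ʳ []       u       = u
unique-++ʳ (_ ∷ xs) (_ ∷ u) = unique-++ʳ xs u

data Walk {A : Set} (E : A → A → Set) : A → List A → A → Set where
  last : ∀ {a b} → E a b → Walk E a [] b
  step : ∀ {a x xs b} → E a x → Walk E x xs b → Walk E a (x ∷ xs) b

-- `xs` lists the vertices other than `a`, so its length is even when the cycle is odd.
OddCycle : ∀ {A : Set} → (A → A → Set) → A × List A → Set
OddCycle E (a , xs) = Walk E a xs a × Even (length xs)

module _ {A : Set} where

  walk-++ : ∀ {E : A → A → Set} {a ys u zs b} → Walk E a ys u → Walk E u zs b → Walk E a (ys ++ u ∷ zs) b
  walk-++ (last e)   w = step e w
  walk-++ (step e v) w = step e (walk-++ v w)

  walk-split : ∀ {E : A → A → Set} {a} ys {u zs b} → Walk E a (ys ++ u ∷ zs) b → Walk E a ys u × Walk E u zs b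
  walk-split []       (step e w) = last e , w
  walk-split (y ∷ ys) (step e w) = let v , w′ = walk-split ys w in step e v , w′

  walk-map : ∀ {E F : A → A → Set} {P : A → Set} → (∀ {i j} → P i → P j → E i j → F i j) →
    ∀ {a xs b} → P a → All P xs → P b → Walk E a xs b → Walk F a xs b
  walk-map f pa []         pb (last e)   = last (f pa pb e)
  walk-map f pa (px ∷ pxs) pb (step e w) = step (f pa px e) (walk-map f px pxs pb w)

  rotate-cycle : ∀ {E : A → A → Set} {a xs u} → OddCycle E (a , xs) → u ∈ a ∷ xs →
    ∃ λ ys → OddCycle E (u , ys) × a ∷ xs ↭ u ∷ ys
  rotate-cycle {xs = xs} c (here refl) = xs , c , ↭-refl
  rotate-cycle {a = a} {u = u} (w , even) (there p) with ys , zs , refl ← ∈-∃++ p =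
    let v , v′ = walk-split ys w in
    zs ++ a ∷ ys , (walk-++ v′ v , subst Even lengths even) , ++-comm (a ∷ ys) (u ∷ zs)
    where
    lengths : length (ys ++ u ∷ zs) ≡ length (zs ++ a ∷ ys)
    lengths = begin
      length (ys ++ u ∷ zs)         ≡⟨ length-++ ys ⟩
      length ys + suc (length zs)   ≡⟨ +-suc (length ys) _ ⟩
      suc (length ys + length zs)   ≡⟨ cong suc (+-comm (length ys) _) ⟩
      suc (length zs + length ys)   ≡⟨ +-suc (length zs) _ ⟨
      length zs + suc (length ys)   ≡⟨ length-++ zs ⟨
      length (zs ++ a ∷ ys)         ∎
      where open ≡-Reasoning

  flatten : List (A × A) → List A
  flatten []             = []
  flatten ((x , y) ∷ ps) = x ∷ y ∷ flatten ps

  flatten-++ : ∀ ps qs → flatten (ps ++ qs) ≡ flatten ps ++ flatten qs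
  flatten-++ []             qs = refl
  flatten-++ ((x , y) ∷ ps) qs = cong (λ l → x ∷ y ∷ l) (flatten-++ ps qs)

  Joined : (A → A → Set) → A × A → Set
  Joined E (x , y) = E x y

  -- Every other edge is taken, beginning with the second, so that both ends of the walk stay
  -- uncovered.
  pair-up : ∀ {E : A → A → Set} {a xs b} → Walk E a xs b → Even (length xs) →
    ∃ λ ps → flatten ps ≡ xs × All (Joined E) ps
  pair-up (last _) _ = [] , refl , []
  pair-up (step {x = x} _ (step {x = y} e w)) even with pair-up w even
  ... | ps , refl , all = (x , y) ∷ ps , refl , e ∷ all

  span : List (A × List A) → List (A × A) → List A
  span []              ps = flatten ps
  span ((a , xs) ∷ cs) ps = (a ∷ xs) ++ span cs ps

  span-++ : ∀ cs ps qs → span cs (ps ++ qs) ↭ flatten ps ++ span cs qs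
  span-++ []              ps qs = ↭-reflexive (flatten-++ ps qs)
  span-++ ((a , xs) ∷ cs) ps qs = ↭-trans (++⁺ˡ (a ∷ xs) (span-++ cs ps qs)) (shifts (a ∷ xs) (flatten ps))

  -- For a list `vs` without repetitions, a single permutation states both that the pieces are
  -- disjoint and that they cover `vs`.
  record Decomposition (E : A → A → Set) (vs : List A) : Set where
    constructor decomposition
    field
      {cycles} : List (A × List A)
      {pairs}  : List (A × A)
      odd      : All (OddCycle E) cycles
      joined   : All (Joined E) pairs
      spans    : span cycles pairs ↭ vs

  odd-map : ∀ {E F : A → A → Set} {P : A → Set} → (∀ {i j} → P i → P j → E i j → F i j) →
    ∀ cs {ps} → All P (span cs ps) → All (OddCycle E) cs → All (OddCycle F) cs
  odd-map f []              _        []            = []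
  odd-map f ((a , xs) ∷ cs) (p ∷ pp) ((w , e) ∷ c) =
    (walk-map f p (proj₁ (All-++⁻ xs pp)) p w , e) ∷ odd-map f cs (proj₂ (All-++⁻ xs pp)) c

  span-pairs : ∀ {P : A → Set} cs {ps} → All P (span cs ps) → All P (flatten ps)
  span-pairs []              p        = p
  span-pairs ((a , xs) ∷ cs) (_ ∷ pp) = span-pairs cs (proj₂ (All-++⁻ xs pp))

  joined-map : ∀ {E F : A → A → Set} {P : A → Set} → (∀ {i j} → P i → P j → E i j → F i j) →
    ∀ {ps} → All P (flatten ps) → All (Joined E) ps → All (Joined F) ps
  joined-map f []           []       = []
  joined-map f (p ∷ q ∷ pp) (e ∷ es) = f p q e ∷ joined-map f pp es

  -- An odd cycle minus a vertex has a perfect matching.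
  merge-cycles : ∀ {E F : A → A → Set} {vs c₁ c₂ cs ps x v} → Unique vs →
    OddCycle E c₁ → OddCycle E c₂ → All (OddCycle E) cs → All (Joined E) ps →
    span (c₁ ∷ c₂ ∷ cs) ps ↭ vs → x ∈ proj₁ c₁ ∷ proj₂ c₁ → v ∈ proj₁ c₂ ∷ proj₂ c₂ →
    F x v → (∀ {i j} → i ≢ x → i ≢ v → j ≢ x → j ≢ v → E i j → F i j) →
    ∃ λ qs → All (OddCycle F) cs × All (Joined F) qs × span cs qs ↭ vs
  merge-cycles {E} {F} {vs} {a₁ , xs₁} {a₂ , xs₂} {cs} {ps} {x} {v} unique o₁ o₂ os js spans x∈ v∈ Fxv keep
    with rotate-cycle o₁ x∈ | rotate-cycle o₂ v∈
  ... | ys₁ , (w₁ , e₁) , r₁ | ys₂ , (w₂ , e₂) , r₂ with pair-up w₁ e₁ | pair-up w₂ e₂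
  ... | ps₁ , refl , j₁ | ps₂ , refl , j₂ =
    (x , v) ∷ ps₁ ++ ps₂ ++ ps ,
    odd-map keep′ cs {ps} rest os ,
    Fxv ∷ All-++⁺ (joined-map keep′ (proj₁ (All-++⁻ (flatten ps₁) away)) j₁)
            (All-++⁺ (joined-map keep′ (proj₁ (All-++⁻ (flatten ps₂) (proj₂ (All-++⁻ (flatten ps₁) away)))) j₂)
              (joined-map keep′ (span-pairs cs rest) js)) ,
    ↭-trans new (↭-trans (↭-sym old) spans)
    where
    open PermutationReasoning
    Off : A → Set
    Off z = z ≢ x × z ≢ v
    keep′ : ∀ {i j} → Off i → Off j → E i j → F i j
    keep′ (p , q) (r , s) = keep p q r s
    others : List A
    others = flatten ps₁ ++ flatten ps₂ ++ span cs ps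
    old : (a₁ ∷ xs₁) ++ (a₂ ∷ xs₂) ++ span cs ps ↭ x ∷ v ∷ others
    old = begin
      (a₁ ∷ xs₁) ++ (a₂ ∷ xs₂) ++ span cs ps ↭⟨ ++⁺ʳ _ r₁ ⟩
      x ∷ flatten ps₁ ++ (a₂ ∷ xs₂) ++ span cs ps ↭⟨ prep x (++⁺ˡ (flatten ps₁) (++⁺ʳ _ r₂)) ⟩
      x ∷ flatten ps₁ ++ v ∷ flatten ps₂ ++ span cs ps ↭⟨ prep x (shift v (flatten ps₁) _) ⟩
      x ∷ v ∷ others ∎
    new : span cs ((x , v) ∷ ps₁ ++ ps₂ ++ ps) ↭ x ∷ v ∷ others
    new = begin
      span cs ((x , v) ∷ ps₁ ++ ps₂ ++ ps) ↭⟨ span-++ cs ((x , v) ∷ ps₁) (ps₂ ++ ps) ⟩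
      x ∷ v ∷ flatten ps₁ ++ span cs (ps₂ ++ ps) ↭⟨ ++⁺ˡ (x ∷ v ∷ flatten ps₁) (span-++ cs ps₂ ps) ⟩
      x ∷ v ∷ others ∎
    apart : ∀ {ws : List A} → Unique (x ∷ v ∷ ws) → All Off ws
    apart ((_ ∷ p) ∷ q ∷ _) = All.zipWith (λ (a , b) → ≢-sym a , ≢-sym b) (p , q)
    away : All Off others
    away = apart (unique-resp-↭ (↭-trans (↭-sym spans) old) unique)
    rest : All Off (span cs ps)
    rest = proj₂ (All-++⁻ (flatten ps₂) (proj₂ (All-++⁻ (flatten ps₁) away)))

-- Splitting a permutation into edges and odd cycles

module Orbits {A : Set} (E : A → A → Set) (π : A → A) (edge : ∀ x → E x (π x))
  (inj : ∀ {x y} → π x ≡ π y → x ≡ y) where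

  private
    -- The orbit of `x` followed as far as `c`, with `ys` the part after `x`; it grows at the end,
    -- where `π` is applied next.
    data Trail (x : A) : List A → A → Set where
      start : Trail x [] x
      snoc  : ∀ {ys c} → Trail x ys c → Trail x (ys ++ π c ∷ []) (π c)

    trail-walk : ∀ {x ys c d} → Trail x ys c → E c d → Walk E x ys d
    trail-walk start    e = last e
    trail-walk (snoc t) e = walk-++ (trail-walk t (edge _)) (last e)

    trail-end : ∀ {x ys c} → Trail x ys c → c ∈ x ∷ ys
    trail-end start            = here refl
    trail-end (snoc {ys} _) = there (∈-++⁺ʳ ys (here refl))

    preimage : ∀ {x ys c o} → Trail x ys c → o ∈ ys → ∃ λ o′ → o′ ∈ x ∷ ys × o ≡ π o′
    before : ∀ {x ys c o} → Trail x ys c → o ∈ ys ++ π c ∷ [] → ∃ λ o′ → o′ ∈ x ∷ ys × o ≡ π o′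
    preimage (snoc t) p = let o′ , q , r = before t p in o′ , ∈-++⁺ˡ q , r
    before {ys = ys} {c} t p with ∈-++⁻ ys p
    ... | inj₁ q           = preimage t q
    ... | inj₂ (here refl) = c , trail-end t , refl

    -- By injectivity, the predecessor of the vertex returned to would equal the end of the trail
    -- and so repeat it. An orbit can therefore close up only at `x`.
    no-return : ∀ {x ys c} → Trail x ys c → Unique (x ∷ ys) → π c ∈ ys → ⊥
    no-return {x} (snoc {ys} {c} t) u p =
      let o′ , q , r = before t p in
      unique-disjoint (x ∷ ys) u (subst (_∈ x ∷ ys) (sym (inj r)) q) (here refl)

    record Orbit (x : A) (vs : List A) : Set where
      field
        {os rest} : List A
        walk      : Walk E x os x
        splits    : vs ↭ x ∷ os ++ rest
        closed    : ∀ {z} → z ∈ rest → π z ∈ rest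

    unique-++ˡ : ∀ (xs : List A) {ys} → Unique (xs ++ ys) → Unique xs
    unique-++ˡ []       _       = []
    unique-++ˡ (x ∷ xs) (a ∷ u) = proj₁ (All-++⁻ xs a) ∷ unique-++ˡ xs u

    orbit : ∀ m {x ys c} rest → length rest ≤ m → Trail x ys c → Unique (x ∷ ys ++ rest) →
      (∀ {z} → z ∈ x ∷ ys ++ rest → π z ∈ x ∷ ys ++ rest) → Orbit x (x ∷ ys ++ rest)
    orbit m {x} {ys} {c} rest ≤m t u closed with closed (∈-++⁺ˡ (trail-end t))
    ... | here eq = record { walk = trail-walk t (subst (E c) eq (edge c)) ; splits = ↭-refl ; closed = closed′ }
      where
      closed′ : ∀ {z} → z ∈ rest → π z ∈ rest
      closed′ {z} p with ∈-++⁻ (x ∷ ys) (closed (∈-++⁺ʳ (x ∷ ys) p))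
      ... | inj₂ q = q
      ... | inj₁ (here q) = ⊥-elim (unique-disjoint (x ∷ ys) u (subst (_∈ x ∷ ys) (inj (trans eq (sym q))) (trail-end t)) p)
      ... | inj₁ (there q) = let o′ , o′∈ , r = preimage t q in
        ⊥-elim (unique-disjoint (x ∷ ys) u (subst (_∈ x ∷ ys) (sym (inj r)) o′∈) p)
    ... | there p with ∈-++⁻ ys p
    ...   | inj₁ q = ⊥-elim (no-return t (unique-++ˡ (x ∷ ys) u) q)
    ...   | inj₂ q with ∈-∃++ q
    orbit zero _ () t u closed | there p | inj₂ q | [] , r , refl
    orbit zero _ () t u closed | there p | inj₂ q | _ ∷ _ , r , refl
    orbit (suc m) {x} {ys} {c} rest ≤m t u closed | there p | inj₂ q | l , r , refl =
      record { walk = O.walk ; splits = ↭-trans move O.splits ; closed = O.closed }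
      where
      move : x ∷ ys ++ l ++ π c ∷ r ↭ x ∷ (ys ++ π c ∷ []) ++ l ++ r
      move = prep x (↭-trans (++⁺ˡ ys (shift (π c) l r)) (↭-reflexive (sym (++-assoc ys (π c ∷ []) (l ++ r)))))
      shorter : length (l ++ r) ≤ m
      shorter = s≤s⁻¹ (≤-trans (≤-reflexive (sym (↭-length (shift (π c) l r)))) ≤m)
      module O = Orbit (orbit m (l ++ r) shorter (snoc t) (unique-resp-↭ move u)
        (λ z∈ → ∈-resp-↭ move (closed (∈-resp-↭ (↭-sym move) z∈))))

  decompose′ : ∀ m vs → length vs ≤ m → Unique vs → (∀ {z} → z ∈ vs → π z ∈ vs) → Decomposition E vs
  decompose′ m       []       _  _ _      = decomposition {cycles = []} {[]} [] [] ↭-refl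
  decompose′ (suc m) (x ∷ vs) ≤m u closed = build (even-or-odd (length O.os)) O.walk refl
    where
    module O = Orbit (orbit (length vs) vs ≤-refl start u closed)
    shorter : length O.rest ≤ m
    shorter = ≤-trans (≤-trans (subst (length O.rest ≤_) (sym (length-++ O.os)) (m≤n+m _ (length O.os)))
      (≤-reflexive (sym (cong pred (↭-length O.splits))))) (s≤s⁻¹ ≤m)
    module D = Decomposition (decompose′ m O.rest shorter (unique-++ʳ (x ∷ O.os) (unique-resp-↭ O.splits u)) O.closed)
    build : ∀ {os} → Even (length os) ⊎ Even (suc (length os)) → Walk E x os x → os ≡ O.os → Decomposition E (x ∷ vs)
    build (inj₁ even) w refl = decomposition {cycles = (x , O.os) ∷ D.cycles} {D.pairs} ((w , even) ∷ D.odd) D.joined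
      (↭-trans (++⁺ˡ (x ∷ O.os) D.spans) (↭-sym O.splits))
    -- An even orbit is replaced by alternate edges, beginning with the one from `x`; an orbit of
    -- two vertices becomes a single pair.
    build (inj₂ odd) (step {x = o} e w) eq with pair-up w odd
    ... | ps , refl , j = decomposition {cycles = D.cycles} {(x , o) ∷ ps ++ D.pairs} D.odd (e ∷ All-++⁺ j D.joined)
      (↭-trans (span-++ D.cycles ((x , o) ∷ ps) D.pairs)
        (↭-trans (++⁺ˡ (x ∷ o ∷ flatten ps) D.spans)
          (↭-trans (↭-reflexive (cong (λ l → x ∷ l ++ O.rest) eq)) (↭-sym O.splits))))

  decompose : ∀ vs → Unique vs → (∀ {z} → z ∈ vs → π z ∈ vs) → Decomposition E vs
  decompose vs = decompose′ (length vs) vs ≤-refl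

-- Monotone paths in odd cycles

record Monotone {A : Set} (E _≲_ : A → A → Set) : Set where
  constructor monotone
  field
    {x y z} : A
    xy      : E x y
    yz      : E y z
    x≲y     : x ≲ y
    y≲z     : y ≲ z

module _ {A : Set} {E : A → A → Set} (E-sym : ∀ {x y} → E x y → E y x) where

  private
    -- The two outer edges ascend and the number of edges between them is even, so ascents and
    -- descents cannot alternate throughout. Two consecutive descents count as ascents when read
    -- backwards.
    zigzag : ∀ {_≲_ : A → A → Set} → (∀ x y → x ≲ y ⊎ y ≲ x) → ∀ {p a xs c d} → E p a → p ≲ a →
      Walk E a xs c → Even (suc (length xs)) → E c d → c ≲ d → Monotone E _≲_
    zigzag total pa p≲a (step {a} {x} ax w) odd cd c≲d with total a x
    ... | inj₁ a≲x = monotone pa ax p≲a a≲x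
    zigzag total pa p≲a (step {a} {x} ax (last {b = c} xc)) odd cd c≲d | inj₂ x≲a with total x c
    ... | inj₁ x≲c = monotone xc cd x≲c c≲d
    ... | inj₂ c≲x = monotone (E-sym xc) (E-sym ax) c≲x x≲a
    zigzag total pa p≲a (step {a} {x} ax (step {x = y} xy w)) odd cd c≲d | inj₂ x≲a with total x y
    ... | inj₁ x≲y = zigzag total xy x≲y w odd cd c≲d
    ... | inj₂ y≲x = monotone (E-sym xy) (E-sym ax) y≲x x≲a

  -- The first edge of the cycle serves as both outer edges of the zigzag around the rest. If it
  -- descends, the order is reversed and the path found is read backwards.
  odd-cycle-monotone : ∀ {_≲_ : A → A → Set} → (∀ x y → x ≲ y ⊎ y ≲ x) → ∀ {c} → OddCycle E c → Monotone E _≲_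
  odd-cycle-monotone total {a , _} (last aa , _) with total a a
  ... | inj₁ p = monotone aa aa p p
  ... | inj₂ p = monotone aa aa p p
  odd-cycle-monotone {_≲_} total {a , _} (step {x = x} ax w , even) with total a x
  ... | inj₁ a≲x = zigzag total ax a≲x w even ax a≲x
  ... | inj₂ x≲a with zigzag {flip _≲_} (flip total) ax x≲a w even ax x≲a
  ...   | monotone xy yz x≳y y≳z = monotone (E-sym yz) (E-sym xy) y≳z x≳y

-- Perfect matchings as involutions

module _ {n : ℕ} where

  -- A vertex in no pair is its own mate; this default does not occur once the pairs span all
  -- vertices.
  mate : List (Fin n × Fin n) → Fin n → Fin n
  mate []             i = i
  mate ((x , y) ∷ ps) i with i ≟ x | i ≟ y
  ... | yes _ | _     = y
  ... | no _  | yes _ = x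
  ... | no _  | no _  = mate ps i

  mate-∈ : ∀ ps {i} → i ∈ flatten ps → mate ps i ∈ flatten ps
  mate-∈ ((x , y) ∷ ps) {i} p with i ≟ x | i ≟ y
  ... | yes _ | _     = there (here refl)
  ... | no _  | yes _ = here refl
  mate-∈ ((x , y) ∷ ps) (here q)          | no i≢x | no i≢y = ⊥-elim (i≢x q)
  mate-∈ ((x , y) ∷ ps) (there (here q))  | no i≢x | no i≢y = ⊥-elim (i≢y q)
  mate-∈ ((x , y) ∷ ps) (there (there p)) | no i≢x | no i≢y = there (there (mate-∈ ps p))

  mate-joined : ∀ {E : Fin n → Fin n → Set} → (∀ {x y} → E x y → E y x) → ∀ ps → All (Joined E) ps →
    ∀ {i} → i ∈ flatten ps → E i (mate ps i)
  mate-joined E-sym ((x , y) ∷ ps) (e ∷ es) {i} p with i ≟ x | i ≟ y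
  ... | yes refl | _        = e
  ... | no _     | yes refl = E-sym e
  mate-joined E-sym ((x , y) ∷ ps) (e ∷ es) (here q)          | no i≢x | no i≢y = ⊥-elim (i≢x q)
  mate-joined E-sym ((x , y) ∷ ps) (e ∷ es) (there (here q))  | no i≢x | no i≢y = ⊥-elim (i≢y q)
  mate-joined E-sym ((x , y) ∷ ps) (e ∷ es) (there (there p)) | no i≢x | no i≢y = mate-joined E-sym ps es p

  mate-involutive : ∀ ps → Unique (flatten ps) → ∀ {i} → i ∈ flatten ps → mate ps (mate ps i) ≡ i
  mate-involutive ((x , y) ∷ ps) ((x≢y ∷ x∉) ∷ y∉ ∷ u) {i} p with i ≟ x | i ≟ y
  ... | yes refl | _ with y ≟ x | y ≟ y
  ...   | yes refl | _     = refl
  ...   | no _ | yes _     = refl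
  ...   | no _ | no y≢y    = ⊥-elim (y≢y refl)
  mate-involutive ((x , y) ∷ ps) ((x≢y ∷ x∉) ∷ y∉ ∷ u) {i} p | no _ | yes refl with x ≟ x
  ...   | yes _ = refl
  ...   | no x≢x = ⊥-elim (x≢x refl)
  mate-involutive ((x , y) ∷ ps) _ (here q) | no i≢x | no i≢y = ⊥-elim (i≢x q)
  mate-involutive ((x , y) ∷ ps) _ (there (here q)) | no i≢x | no i≢y = ⊥-elim (i≢y q)
  mate-involutive ((x , y) ∷ ps) ((x≢y ∷ x∉) ∷ y∉ ∷ u) {i} (there (there p)) | no i≢x | no i≢y
    with mate ps i ≟ x | mate ps i ≟ y
  ... | yes q | _     = ⊥-elim (All.lookup x∉ (mate-∈ ps p) (sym q))
  ... | no _  | yes q = ⊥-elim (All.lookup y∉ (mate-∈ ps p) (sym q))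
  ... | no _  | no _  = mate-involutive ps u p

-- Splitting off perfect matchings

-- W: non-edges of G. B: edges of G outside the k-factor. R: the part of the k-factor still to be split.
-- M s: the edges of the s-th perfect matching.
Colour : Set
Colour = Fin 8

pattern diag = zero
pattern W    = suc zero
pattern B    = suc (suc zero)
pattern R    = suc (suc (suc zero))
pattern M s  = suc (suc (suc (suc s)))

-- The number of entries of each colour in row `i`. The diagonal has a colour of its own, occurring
-- once; `a s` is 1 or 0 according to whether the matching `s` has been split off.
profile : ∀ {n} → (w b : Fin n → ℕ) → ℕ → (Fin 4 → ℕ) → Colour → Fin n → ℕ
profile w b t a diag  i = 1
profile w b t a W     i = w i
profile w b t a B     i = b i
profile w b t a R     i = t
profile w b t a (M s) i = a s

record Colouring {n} (D : Colour → Fin n → ℕ) : Set where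
  field
    col       : Fin n → Fin n → Colour
    col-sym   : ∀ i j → col i j ≡ col j i
    col-diag  : ∀ i → col i i ≡ diag
    col-count : ∀ i c → count (col i) c ≡ D c i
open Colouring

count-unique : ∀ {n m} (row : Fin n → Fin m) {c i j} → count row c ≤ 1 → row i ≡ c → row j ≡ c → i ≡ j
count-unique row {c} {i} {j} ≤1 ri rj with i ≟ j
... | yes p = p
... | no i≢j = ⊥-elim (<⇒≱ two ≤1)
  where
  two : 1 < count row c
  two = subst (_< count row c) (sum-single (λ _ → 1) i)
    (sum-mono-< pointwise j (subst₂ _<_ (sym (cong ind (dec-false (j ≟ i) (≢-sym i≢j))))
      (sym (cong ind (dec-true (c ≟ row j) (sym rj)))) ≤-refl))
    where
    pointwise : ∀ z → when (does (z ≟ i)) 1 ≤ ind (does (c ≟ row z))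
    pointwise z with z ≟ i
    ... | no _     = z≤n
    ... | yes refl = ≤-reflexive (sym (cong ind (dec-true (c ≟ row i) (sym ri))))

count-absent : ∀ {n m} (row : Fin n → Fin m) {c} → count row c ≡ 0 → ∀ i → row i ≢ c
count-absent row {c} none i ri = <⇒≱ (≤-trans (≤-reflexive (sym (cong ind (dec-true (c ≟ row i) (sym ri)))))
  (term≤sum (λ j → ind (does (c ≟ row j))) i)) (≤-reflexive none)

vertices : ∀ {A : Set} → A × List A → List A
vertices (a , xs) = a ∷ xs

mark : Fin 4 → (Fin 4 → ℕ) → Fin 4 → ℕ
mark f a s = if does (s ≟ f) then 1 else a s

mark≤1 : ∀ f a → (∀ s → a s ≤ 1) → ∀ s → mark f a s ≤ 1
mark≤1 f a a≤1 s with does (s ≟ f)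
... | true  = ≤-refl
... | false = a≤1 s

module Stage {n} (n-even : Even n) (w b : Fin n → ℕ) {κ} (w+b : ∀ i → w i + b i ≡ κ)
  (t : ℕ) (a : Fin 4 → ℕ) (a≤1 : ∀ s → a s ≤ 1) (f : Fin 4) (af : a f ≡ 0) where

  D : Colour → Fin n → ℕ
  D = profile w b (suc t) a

  Red : Colouring D → Fin n → Fin n → Set
  Red K i j = col K i j ≡ R

  red-sym : ∀ K {i j} → Red K i j → Red K j i
  red-sym K {i} {j} = trans (col-sym K j i)

  col-diag⁻ : ∀ (K : Colouring D) {i j} → col K i j ≡ diag → i ≡ j
  col-diag⁻ K {i} = count-unique (col K i) (≤-reflexive (col-count K i diag)) (col-diag K i)

  red-distinct : ∀ (K : Colouring D) {i j} → Red K i j → i ≢ j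
  red-distinct K {i} ij refl with () ← trans (sym (col-diag K i)) ij

  exchanged : (K : Colouring D) → ∀ {u v S c} → S u ≡ false → S v ≡ false → Shift (col K) u v S c c → Colouring D
  exchanged K {u} {v} {S} Su Sv sh = record
    { col       = exchange S u v (col K)
    ; col-sym   = exchange-sym (col K) (col-sym K) {u} {v} {S} Su Sv
    ; col-diag  = exchange-diag (col K) (col-sym K) {u} {v} {S} Su Sv (col-diag K)
    ; col-count = λ i c → trans (exchange-row (col K) (col-sym K) Su Sv sh (λ e → ind (does (c ≟ e))) i) (col-count K i c)
    }

  -- Losing red edges at `x` or `v` is harmless: these two are going to be matched to each other,
  -- and the other pairs and cycles avoid them.
  record Joining (K : Colouring D) (x v : Fin n) : Set where
    constructor joining
    field
      K′   : Colouring D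
      join : Red K′ x v
      keep : ∀ {i j} → i ≢ x → i ≢ v → j ≢ x → j ≢ v → Red K i j → Red K′ i j

  joining-sym : ∀ {K x v} → Joining K x v → Joining K v x
  joining-sym (joining K′ j k) = joining K′ (red-sym K′ j) (λ p q r s → k q p s r)

  w-antitone : ∀ {i j} → b i ≤ b j → w j ≤ w i
  w-antitone {i} {j} bi≤bj = +-cancelʳ-≤ (b i) _ _
    (≤-trans (+-monoʳ-≤ (w j) bi≤bj) (≤-reflexive (trans (w+b j) (sym (w+b i)))))

  -- `xv` takes over the red of `ux`. Edges away from `u` and `v` keep their colour, and among the
  -- red edges at `u` only `ux` can be lost.
  apply-switch : ∀ K {u v x} {S : Fin n → Bool} → S u ≡ false → S v ≡ false → Shift (col K) u v S R R →
    S x ≡ true → (∀ z → S z ≡ true → Red K u z → z ≡ x) → Red K u x → Joining K x v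
  apply-switch K {u} {v} {x} {S} Su Sv balanced Sx only-x ux = joining K′ join keep
    where
    K′ = exchanged K Su Sv balanced
    join : Red K′ x v
    join = trans (col-sym K′ x v) (trans (exchange-right (col K) (col-sym K) Su Sv x)
      (trans (cong (λ s → col K (if s then u else v) x) Sx) ux))
    at-u : ∀ {j} → j ≢ x → Red K u j → Red K′ u j
    at-u {j} j≢x uj = trans (exchange-left (col K) (col-sym K) Su Sv j)
      (trans (cong (λ s → col K (if s then v else u) j) Sj) uj)
      where
      Sj : S j ≡ false
      Sj with S j in eq
      ... | false = refl
      ... | true  = ⊥-elim (j≢x (only-x j eq uj))
    keep-by : ∀ {i j} → Dec (i ≡ u) → Dec (j ≡ u) → i ≢ x → i ≢ v → j ≢ x → j ≢ v → Red K i j → Red K′ i j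
    keep-by (yes refl) _          _   _   j≢x _   ij = at-u j≢x ij
    keep-by (no _)     (yes refl) i≢x _   _   _   ij = red-sym K′ (at-u i≢x (red-sym K ij))
    keep-by (no p)     (no q)     _   i≢v _   j≢v ij = trans (exchange-off (col K) (col-sym K) Su Sv p i≢v q j≢v) ij
    keep : ∀ {i j} → i ≢ x → i ≢ v → j ≢ x → j ≢ v → Red K i j → Red K′ i j
    keep {i} {j} = keep-by (i ≟ u) (j ≟ u)

  switch-to-red : ∀ K {u v x c} → Red K u x → col K v x ≡ c → x ≢ v →
    (∀ e → e ≢ c → D e u ≤ D e v) → Joining K x v
  switch-to-red K {u} {v} {x} ux vx x≢v degrees =
    apply-switch K {S = S.S} S.Su S.Sv S.balanced S.Sx S.only-x ux
    where
    module MS = MultiSwitch (col K) (col-sym K) (col-diag K) {u} {v} {x} ux vx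
      (≢-sym (red-distinct K ux)) x≢v
      (λ e p → subst₂ _≤_ (sym (col-count K u e)) (sym (col-count K v e)) (degrees e p))
    module S = MS.Switch MS.switch

  -- The rotation makes `uv` red at the expense of `ux` and `vy`, each of which meets `u` or `v`.
  four-cycle : ∀ K {u x y v} → Red K u x → Red K v y → col K u v ≡ col K x y →
    x ≢ y → v ≢ u → x ≢ v → Joining K u v
  four-cycle K {u} {x} {y} {v} ux vy uv≡xy x≢y v≢u x≢v = joining K′ rotated-uv keep
    where
    open FourCycle (col K) (col-sym K) ux refl (red-sym K vy) uv≡xy
      (≢-sym (red-distinct K ux)) x≢y v≢u (red-distinct K vy) x≢v
    K′ : Colouring D
    K′ = record
      { col = rotated ; col-sym = rotated-sym ; col-diag = rotated-diag (col-diag K)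
      ; col-count = λ i c → trans (rotated-row (λ e → ind (does (c ≟ e))) i) (col-count K i c) }
    keep : ∀ {i j} → i ≢ u → i ≢ v → j ≢ u → j ≢ v → Red K i j → Red K′ i j
    keep {i} {j} i≢u i≢v j≢u j≢v ij with view i j
    ... | same p           = trans p ij
    ... | gained _ p       = p
    ... | lost _ _ lost-ux = ⊥-elim (i≢u refl)
    ... | lost _ _ lost-xu = ⊥-elim (j≢u refl)
    ... | lost _ _ lost-yv = ⊥-elim (j≢v refl)
    ... | lost _ _ lost-vy = ⊥-elim (i≢v refl)

  degrees-W : ∀ {u v} → b u ≤ b v → ∀ e → e ≢ W → D e u ≤ D e v
  degrees-W _ diag  _ = ≤-refl
  degrees-W _ W     p = ⊥-elim (p refl)
  degrees-W h B     _ = h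
  degrees-W _ R     _ = ≤-refl
  degrees-W _ (M _) _ = ≤-refl

  degrees-B : ∀ {u v} → b v ≤ b u → ∀ e → e ≢ B → D e u ≤ D e v
  degrees-B _ diag  _ = ≤-refl
  degrees-B h W     _ = w-antitone h
  degrees-B _ B     p = ⊥-elim (p refl)
  degrees-B _ R     _ = ≤-refl
  degrees-B _ (M _) _ = ≤-refl

  -- A non-edge `xv` becomes red by a switch between `u` and `v`, an edge outside the k-factor by a
  -- switch between `y` and `x`; the two inequalities are the degree conditions for these. Only a
  -- matching edge resists.
  cross : ∀ K {u x v y} → Red K u x → Red K v y → x ≢ v → b u ≤ b v → b x ≤ b y →
    Joining K x v ⊎ ∃ λ s → col K x v ≡ M s
  cross K {u} {x} {v} {y} ux vy x≢v u≤v x≤y with col K x v in xv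
  ... | diag = ⊥-elim (x≢v (col-diag⁻ K xv))
  ... | W    = inj₁ (switch-to-red K ux (trans (col-sym K v x) xv) x≢v (degrees-W u≤v))
  ... | B    = inj₁ (joining-sym (switch-to-red K (red-sym K vy) xv (≢-sym x≢v) (degrees-B x≤y)))
  ... | R    = inj₁ (joining K xv (λ _ _ _ _ e → e))
  ... | M s  = inj₂ (s , refl)

  -- When both ends of ux lie below both ends of vy, the four edges between them lie in the matchings;
  -- were no join possible, they would belong to four different matchings other than the f-th.
  join-below : ∀ K {u x v y} → Red K u x → Red K v y → u ≢ v → u ≢ y → x ≢ v → x ≢ y →
    b u ≤ b v → b u ≤ b y → b x ≤ b v → b x ≤ b y →
    Joining K u v ⊎ Joining K u y ⊎ Joining K x v ⊎ Joining K x y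
  join-below K {u} {x} {v} {y} ux vy u≢v u≢y x≢v x≢y u≤v u≤y x≤v x≤y
    with cross K (red-sym K ux) vy u≢v x≤v u≤y | cross K (red-sym K ux) (red-sym K vy) u≢y x≤y u≤v
       | cross K ux vy x≢v u≤v x≤y | cross K ux (red-sym K vy) x≢y u≤y x≤v
  ... | inj₁ J | _ | _ | _ = inj₁ J
  ... | inj₂ _ | inj₁ J | _ | _ = inj₂ (inj₁ J)
  ... | inj₂ _ | inj₂ _ | inj₁ J | _ = inj₂ (inj₂ (inj₁ J))
  ... | inj₂ _ | inj₂ _ | inj₂ _ | inj₁ J = inj₂ (inj₂ (inj₂ J))
  ... | inj₂ (s₁ , uv) | inj₂ (s₂ , uy) | inj₂ (s₃ , xv) | inj₂ (s₄ , xy) =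
    let i , j , i<j , e = pigeonhole ≤-refl colour in clash i j i<j e
    where
    colour : Fin 5 → Fin 4
    colour 0F = f
    colour 1F = s₁
    colour 2F = s₂
    colour 3F = s₃
    colour 4F = s₄
    unused : ∀ {i j s} → col K i j ≡ M s → f ≢ s
    unused {i} {j} ij refl = count-absent (col K i) (trans (col-count K i (M f)) af) j ij
    proper : ∀ {i j l s s′} → col K i j ≡ M s → col K i l ≡ M s′ → s ≡ s′ → j ≡ l
    proper {i} {s = s} ij il refl = count-unique (col K i) (≤-trans (≤-reflexive (col-count K i (M s))) (a≤1 s)) ij il
    flipped : ∀ {i j s} → col K i j ≡ M s → col K j i ≡ M s
    flipped {i} {j} = trans (col-sym K j i)
    clash : ∀ i j → i Fin.< j → colour i ≡ colour j → Joining K u v ⊎ Joining K u y ⊎ Joining K x v ⊎ Joining K x y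
    clash 0F 0F () _
    clash 0F 1F _ e = ⊥-elim (unused uv e)
    clash 0F 2F _ e = ⊥-elim (unused uy e)
    clash 0F 3F _ e = ⊥-elim (unused xv e)
    clash 0F 4F _ e = ⊥-elim (unused xy e)
    clash 1F 0F () _
    clash 1F 1F (s≤s ()) _
    clash 1F 2F _ e = ⊥-elim (red-distinct K vy (proper uv uy e))
    clash 1F 3F _ e = ⊥-elim (red-distinct K ux (proper (flipped uv) (flipped xv) e))
    clash 1F 4F _ e = inj₁ (four-cycle K ux vy (trans uv (trans (cong M e) (sym xy))) x≢y (≢-sym u≢v) x≢v)
    clash 2F 0F () _
    clash 2F 1F (s≤s ()) _
    clash 2F 2F (s≤s (s≤s ())) _
    clash 2F 3F _ e = inj₂ (inj₁ (four-cycle K ux (red-sym K vy) (trans uy (trans (cong M e) (sym xv))) x≢v (≢-sym u≢y) x≢y))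
    clash 2F 4F _ e = ⊥-elim (red-distinct K ux (proper (flipped uy) (flipped xy) e))
    clash 3F 0F () _
    clash 3F 1F (s≤s ()) _
    clash 3F 2F (s≤s (s≤s ())) _
    clash 3F 3F (s≤s (s≤s (s≤s ()))) _
    clash 3F 4F _ e = ⊥-elim (red-distinct K vy (proper xv xy e))
    clash 4F 0F () _
    clash 4F 1F (s≤s ()) _
    clash 4F 2F (s≤s (s≤s ())) _
    clash 4F 3F (s≤s (s≤s (s≤s ()))) _
    clash 4F 4F (s≤s (s≤s (s≤s (s≤s ())))) _

  -- Membership is carried along so that a monotone path found in a cycle is known to have its
  -- vertices there.
  RedIn : Colouring D → List (Fin n) → Fin n → Fin n → Set
  RedIn K vs i j = Red K i j × i ∈ vs × j ∈ vs

  red-in-sym : ∀ K vs {i j} → RedIn K vs i j → RedIn K vs j i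
  red-in-sym K vs (e , i∈ , j∈) = red-sym K e , j∈ , i∈

  monotone-in : ∀ K c → OddCycle (Red K) c → Monotone (RedIn K (vertices c)) (λ i j → b i ≤ b j)
  monotone-in K c@(a , xs) (walk , even) = odd-cycle-monotone (λ {i} {j} → red-in-sym K (a ∷ xs) {i} {j})
    (λ i j → ≤-total (b i) (b j)) {c}
    (walk-map {P = _∈ a ∷ xs} (λ i∈ j∈ e → e , i∈ , j∈) (here refl) (All.tabulate there) (here refl) walk , even)

  record JoiningCycles (K : Colouring D) (c₁ c₂ : Fin n × List (Fin n)) : Set where
    constructor joining-cycles
    field
      {x v}   : Fin n
      x∈      : x ∈ vertices c₁
      v∈      : v ∈ vertices c₂
      joins   : Joining K x v

  module _ (K : Colouring D) {c₁ c₂ : Fin n × List (Fin n)}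
    (disjoint : ∀ {i j} → i ∈ vertices c₁ → j ∈ vertices c₂ → i ≢ j) where

    -- The middle vertices p and q of monotone paths satisfy b p ≤ b q, so the lower edge at p lies
    -- below the upper edge at q.
    join-cycles-≤ : (P : Monotone (RedIn K (vertices c₁)) (λ i j → b i ≤ b j)) →
      (Q : Monotone (RedIn K (vertices c₂)) (λ i j → b i ≤ b j)) →
      b (Monotone.y P) ≤ b (Monotone.y Q) → JoiningCycles K c₁ c₂
    join-cycles-≤ (monotone (ux , u∈ , x∈) _ u≤x _) (monotone _ (vy , v∈ , y∈) _ v≤y) x≤v
      with join-below K ux vy (disjoint u∈ v∈) (disjoint u∈ y∈) (disjoint x∈ v∈) (disjoint x∈ y∈)
             (≤-trans u≤x x≤v) (≤-trans u≤x (≤-trans x≤v v≤y)) x≤v (≤-trans x≤v v≤y)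
    ... | inj₁ J                 = joining-cycles u∈ v∈ J
    ... | inj₂ (inj₁ J)          = joining-cycles u∈ y∈ J
    ... | inj₂ (inj₂ (inj₁ J))   = joining-cycles x∈ v∈ J
    ... | inj₂ (inj₂ (inj₂ J))   = joining-cycles x∈ y∈ J

  join-cycles : ∀ K {c₁ c₂} → OddCycle (Red K) c₁ → OddCycle (Red K) c₂ →
    (∀ {i j} → i ∈ vertices c₁ → j ∈ vertices c₂ → i ≢ j) → JoiningCycles K c₁ c₂
  join-cycles K {c₁} {c₂} o₁ o₂ disjoint =
    compare (monotone-in K c₁ o₁) (monotone-in K c₂ o₂)
    where
    compare : Monotone (RedIn K (vertices c₁)) (λ i j → b i ≤ b j) →
      Monotone (RedIn K (vertices c₂)) (λ i j → b i ≤ b j) → JoiningCycles K c₁ c₂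
    compare P Q with ≤-total (b (Monotone.y P)) (b (Monotone.y Q))
    ... | inj₁ p≤q = join-cycles-≤ K disjoint P Q p≤q
    ... | inj₂ q≤p with join-cycles-≤ K (λ i∈ j∈ → ≢-sym (disjoint j∈ i∈)) Q P q≤p
    ...   | joining-cycles v∈ x∈ J = joining-cycles x∈ v∈ (joining-sym J)

  record Matched : Set where
    constructor matched
    field
      K      : Colouring D
      {ps}   : List (Fin n × Fin n)
      joined : All (Joined (Red K)) ps
      spans  : flatten ps ↭ allFin n

  flatten-even : ∀ (ps : List (Fin n × Fin n)) → Even (length (flatten ps))
  flatten-even []       = tt
  flatten-even (_ ∷ ps) = flatten-even ps

  -- Odd cycles disappear two at a time; a single one left over would make `n` odd.
  eliminate : ∀ cs {ps} K → All (OddCycle (Red K)) cs → All (Joined (Red K)) ps →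
    span cs ps ↭ allFin n → Matched
  eliminate [] K [] js spans = matched K js spans
  eliminate ((a , xs) ∷ []) {ps} K ((_ , even) ∷ []) js spans = ⊥-elim
    (even+even (length xs) 1 even (even+even (length (flatten ps)) (length xs + 1) (flatten-even ps) (subst Even lengths n-even)))
    where
    open ≡-Reasoning
    lengths : n ≡ length (flatten ps) + (length xs + 1)
    lengths = begin
      n                                      ≡⟨ length-tabulate id ⟨
      length (allFin n)                      ≡⟨ ↭-length spans ⟨
      suc (length (xs ++ flatten ps))        ≡⟨ cong suc (length-++ xs) ⟩
      suc (length xs + length (flatten ps))  ≡⟨ cong suc (+-comm (length xs) _) ⟩
      suc (length (flatten ps) + length xs)  ≡⟨ +-suc (length (flatten ps)) _ ⟨
      length (flatten ps) + suc (length xs)  ≡⟨ cong (length (flatten ps) +_) (+-comm 1 (length xs)) ⟩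
      length (flatten ps) + (length xs + 1)  ∎
  eliminate (c₁@(a₁ , xs₁) ∷ c₂@(a₂ , xs₂) ∷ cs) {ps} K (o₁ ∷ o₂ ∷ os) js spans =
    merge (join-cycles K o₁ o₂ disjoint)
    where
    disjoint : ∀ {i j} → i ∈ vertices c₁ → j ∈ vertices c₂ → i ≢ j
    disjoint i∈ j∈ refl = unique-disjoint (vertices c₁) (unique-resp-↭ (↭-sym spans) (allFin⁺ n)) i∈ (∈-++⁺ˡ j∈)
    merge : JoiningCycles K c₁ c₂ → Matched
    merge (joining-cycles x∈ v∈ (joining K′ join keep)) =
      let qs , os′ , js′ , spans′ = merge-cycles (allFin⁺ n) o₁ o₂ os js spans x∈ v∈ join keep
      in eliminate cs K′ os′ js′ spans′

  matched-exists : Colouring D → Matched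
  matched-exists K =
    let π , edge , inj = Hall.permutation red (s≤s z≤n) rows columns
        decomposition os js spans = Orbits.decompose (Red K) π (λ x → red-true (edge x)) inj (allFin n) (allFin⁺ n) (λ _ → ∈-allFin _)
    in eliminate _ K os js spans
    where
    red : Fin n → Fin n → Bool
    red i j = does (R ≟ col K i j)
    red-true : ∀ {i j} → red i j ≡ true → Red K i j
    red-true {i} {j} p with R ≟ col K i j
    ... | yes q = sym q
    rows : ∀ i → sum (λ j → ind (red i j)) ≡ suc t
    rows i = col-count K i R
    columns : ∀ j → sum (λ i → ind (red i j)) ≡ suc t
    columns j = trans (sum-cong-≗ (λ i → cong (λ c → ind (does (R ≟ c))) (col-sym K i j))) (rows j)

  recolour : Colouring D → Colouring (profile w b t (mark f a))
  recolour K₀ = record { col = col′ ; col-sym = sym′ ; col-diag = diag′ ; col-count = counts }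
    where
    open Matched (matched-exists K₀)
    μ : Fin n → Fin n
    μ = mate ps
    all∈ : ∀ i → i ∈ flatten ps
    all∈ i = ∈-resp-↭ (↭-sym spans) (∈-allFin i)
    μμ : ∀ i → μ (μ i) ≡ i
    μμ i = mate-involutive ps (unique-resp-↭ (↭-sym spans) (allFin⁺ n)) (all∈ i)
    μ-red : ∀ i → Red K i (μ i)
    μ-red i = mate-joined (red-sym K) ps joined (all∈ i)
    col′ : Fin n → Fin n → Colour
    col′ i j = if does (j ≟ μ i) then M f else col K i j
    sym′ : ∀ i j → col′ i j ≡ col′ j i
    sym′ i j with j ≟ μ i | i ≟ μ j
    ... | yes _    | yes _    = refl
    ... | yes refl | no q     = ⊥-elim (q (sym (μμ i)))
    ... | no p     | yes refl = ⊥-elim (p (sym (μμ j)))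
    ... | no _     | no _     = col-sym K i j
    diag′ : ∀ i → col′ i i ≡ diag
    diag′ i with i ≟ μ i
    ... | yes p = ⊥-elim (red-distinct K (μ-red i) p)
    ... | no _  = col-diag K i
    balance : ∀ i c → count (col′ i) c + ind (does (c ≟ R)) ≡ D c i + ind (does (c ≟ M f))
    balance i c = begin
      count (col′ i) c + ind (does (c ≟ R))
        ≡⟨ cong (count (col′ i) c +_) (sum-single (λ _ → ind (does (c ≟ R))) (μ i)) ⟨
      count (col′ i) c + sum (λ j → when (does (j ≟ μ i)) (ind (does (c ≟ R))))
        ≡⟨ ∑-distrib-+ (λ j → ind (does (c ≟ col′ i j))) _ ⟨
      sum (λ j → ind (does (c ≟ col′ i j)) + when (does (j ≟ μ i)) (ind (does (c ≟ R))))
        ≡⟨ sum-cong-≗ pointwise ⟩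
      sum (λ j → ind (does (c ≟ col K i j)) + when (does (j ≟ μ i)) (ind (does (c ≟ M f))))
        ≡⟨ ∑-distrib-+ (λ j → ind (does (c ≟ col K i j))) _ ⟩
      count (col K i) c + sum (λ j → when (does (j ≟ μ i)) (ind (does (c ≟ M f))))
        ≡⟨ cong₂ _+_ (col-count K i c) (sum-single (λ _ → ind (does (c ≟ M f))) (μ i)) ⟩
      D c i + ind (does (c ≟ M f)) ∎
      where
      open ≡-Reasoning
      pointwise : ∀ j → ind (does (c ≟ col′ i j)) + when (does (j ≟ μ i)) (ind (does (c ≟ R)))
                      ≡ ind (does (c ≟ col K i j)) + when (does (j ≟ μ i)) (ind (does (c ≟ M f)))
      pointwise j with j ≟ μ i
      ... | no _     = refl
      ... | yes refl rewrite μ-red i = +-comm (ind (does (c ≟ M f))) _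
    counts : ∀ i c → count (col′ i) c ≡ profile w b t (mark f a) c i
    counts i diag  = +-cancelʳ-≡ 0 _ _ (balance i diag)
    counts i W     = +-cancelʳ-≡ 0 _ _ (balance i W)
    counts i B     = +-cancelʳ-≡ 0 _ _ (balance i B)
    counts i R     = +-cancelʳ-≡ 1 _ _ (trans (balance i R) (trans (+-identityʳ (suc t)) (+-comm 1 t)))
    counts i (M s) = +-cancelʳ-≡ 0 _ _ (trans (balance i (M s)) (added s))
      where
      added : ∀ s → a s + ind (does (M s ≟ M f)) ≡ mark f a s + 0
      added s with s ≟ f
      ... | yes refl rewrite af = refl
      ... | no _     = refl

-- The initial colouring from a nested pair of graphs

module Initial {n} (G H : Graph n) (nested : ∀ i j → excess H G i j ≡ false)
  (k : ℕ) (diff : ∀ i → degree G i ≡ degree H i + k) where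

  base : Bool → Bool → Colour
  base true  true  = B
  base true  false = R
  base false _     = W

  col₀ : Fin n → Fin n → Colour
  col₀ i j = if does (i ≟ j) then diag else base (adj G i j) (adj H i j)

  w₀ : Fin n → ℕ
  w₀ i = count (col₀ i) W

  initial : Colouring (profile w₀ (degree H) k (λ _ → 0))
  initial = record { col = col₀ ; col-sym = symmetric ; col-diag = diagonal ; col-count = counts }
    where
    symmetric : ∀ i j → col₀ i j ≡ col₀ j i
    symmetric i j with i ≟ j | j ≟ i
    ... | yes _    | yes _    = refl
    ... | yes refl | no q     = ⊥-elim (q refl)
    ... | no p     | yes refl = ⊥-elim (p refl)
    ... | no _     | no _     = cong₂ base (Graph.sym G i j) (Graph.sym H i j)
    diagonal : ∀ i → col₀ i i ≡ diag
    diagonal i rewrite dec-true (i ≟ i) refl = refl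
    base≢diag : ∀ x y → does (diag ≟ base x y) ≡ false
    base≢diag true  true  = refl
    base≢diag true  false = refl
    base≢diag false _     = refl
    counts : ∀ i c → count (col₀ i) c ≡ profile w₀ (degree H) k (λ _ → 0) c i
    counts i diag = trans (sum-cong-≗ pointwise) (sum-single (λ _ → 1) i)
      where
      pointwise : ∀ j → ind (does (diag ≟ col₀ i j)) ≡ when (does (j ≟ i)) 1
      pointwise j with i ≟ j | j ≟ i
      ... | yes _    | yes _    = refl
      ... | yes refl | no q     = ⊥-elim (q refl)
      ... | no p     | yes refl = ⊥-elim (p refl)
      ... | no _     | no _     = cong ind (base≢diag (adj G i j) (adj H i j))
    counts i W = refl
    counts i B = sum-cong-≗ pointwise
      where
      bits : ∀ x y → y ∧ not x ≡ false → ind (does (B ≟ base x y)) ≡ ind y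
      bits true  true  _ = refl
      bits true  false _ = refl
      bits false false _ = refl
      pointwise : ∀ j → ind (does (B ≟ col₀ i j)) ≡ ind (adj H i j)
      pointwise j with i ≟ j
      ... | yes refl rewrite irrefl H i = refl
      ... | no _     = bits (adj G i j) (adj H i j) (nested i j)
    counts i R = trans (sum-cong-≗ pointwise) (+-cancelʳ-≡ (degree H i) _ _ (begin
      surplus G H i + degree H i ≡⟨ surplus-balance G H i ⟩
      surplus H G i + degree G i ≡⟨ cong₂ _+_ (trans (sum-cong-≗ (λ j → cong ind (nested i j))) (sum-replicate-zero n)) (diff i) ⟩
      degree H i + k             ≡⟨ +-comm (degree H i) k ⟩
      k + degree H i             ∎))
      where
      open ≡-Reasoning
      bits : ∀ x y → ind (does (R ≟ base x y)) ≡ ind (x ∧ not y)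
      bits true  true  = refl
      bits true  false = refl
      bits false _     = refl
      pointwise : ∀ j → ind (does (R ≟ col₀ i j)) ≡ ind (excess G H i j)
      pointwise j with i ≟ j
      ... | yes refl rewrite irrefl G i = refl
      ... | no _     = bits (adj G i j) (adj H i j)
    counts i (M s) = trans (sum-cong-≗ pointwise) (sum-replicate-zero n)
      where
      bits : ∀ x y → ind (does (M s ≟ base x y)) ≡ 0
      bits true  true  = refl
      bits true  false = refl
      bits false _     = refl
      pointwise : ∀ j → ind (does (M s ≟ col₀ i j)) ≡ 0
      pointwise j with i ≟ j
      ... | yes _ = refl
      ... | no _  = bits (adj G i j) (adj H i j)

  -- Each entry of row `i` has one of four colours. Hence the number of non-edges plus the degree in
  -- `H` is the same at all vertices, as every stage requires.
  total-count : ∀ i → (w₀ i + degree H i) + (1 + k) ≡ n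
  total-count i = begin
    (w₀ i + degree H i) + (1 + k)
      ≡⟨ cong₂ _+_ (cong (w₀ i +_) (sym (cc B))) (cong₂ _+_ (sym (cc diag)) (sym (cc R))) ⟩
    (w₀ i + count (col₀ i) B) + (count (col₀ i) diag + count (col₀ i) R)
      ≡⟨ cong₂ _+_ (∑-distrib-+ (is W) (is B)) (∑-distrib-+ (is diag) (is R)) ⟨
    sum (λ j → is W j + is B j) + sum (λ j → is diag j + is R j)
      ≡⟨ ∑-distrib-+ (λ j → is W j + is B j) _ ⟨
    sum (λ j → (is W j + is B j) + (is diag j + is R j)) ≡⟨ sum-cong-≗ pointwise ⟩
    sum {n} (λ _ → 1) ≡⟨ sum-one n ⟩
    n ∎
    where
    open ≡-Reasoning
    cc : ∀ c → count (col₀ i) c ≡ profile w₀ (degree H) k (λ _ → 0) c i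
    cc = col-count initial i
    is : Colour → Fin n → ℕ
    is c j = ind (does (c ≟ col₀ i j))
    pointwise : ∀ j → (is W j + is B j) + (is diag j + is R j) ≡ 1
    pointwise j with i ≟ j | adj G i j | adj H i j
    ... | yes _ | _     | _     = refl
    ... | no _  | true  | true  = refl
    ... | no _  | true  | false = refl
    ... | no _  | false | _     = refl

-- From colours back to graphs and factors

module Extract {n} {D : Colour → Fin n → ℕ} (K : Colouring D) (D-diag : ∀ i → D diag i ≡ 1) where

  -- The index is shifted by one to leave out the diagonal colour: 0 is `W`, 1 is `B`, 2 is `R`, and
  -- 3 to 6 are the matchings.
  class : Fin 7 → Graph n
  class c = record
    { adj    = λ i j → does (suc c ≟ col K i j)
    ; sym    = λ i j → cong (λ e → does (suc c ≟ e)) (col-sym K i j)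
    ; irrefl = λ i → cong (λ e → does (suc c ≟ e)) (col-diag K i) }

  class-degree : ∀ c i → deg (class c) i ≡ D (suc c) i
  class-degree c i = trans (deg≡degree (class c) i) (col-count K i (suc c))

  class-disjoint : ∀ c e → c ≢ e → EdgeDisjoint (class c) (class e)
  class-disjoint c e c≢e i j p q with suc c ≟ col K i j | suc e ≟ col K i j
  ... | yes r | yes r′ = c≢e (suc-injective (trans r (sym r′)))

  present : Colour → Bool
  present diag          = false
  present W             = false
  present (suc (suc _)) = true

  union : Graph n
  union = record
    { adj    = λ i j → present (col K i j)
    ; sym    = λ i j → cong present (col-sym K i j)
    ; irrefl = λ i → cong present (col-diag K i) }

  class⊆union : ∀ c → class (suc c) ⊆G union
  class⊆union c i j p with suc (suc c) ≟ col K i j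
  ... | yes r = subst (T ∘ present) r tt

  -- Counting the complement suffices: recolourings preserve the number of non-edges at each vertex,
  -- so the union has the degrees of the original graph.
  union-degree : ∀ i → deg union i + (1 + D W i) ≡ n
  union-degree i = begin
    deg union i + (1 + D W i)
      ≡⟨ cong₂ _+_ (deg≡degree union i) (cong₂ _+_ (sym (trans (col-count K i diag) (D-diag i))) (sym (col-count K i W))) ⟩
    degree union i + (count (col K i) diag + count (col K i) W)
      ≡⟨ cong (degree union i +_) (∑-distrib-+ (is diag) (is W)) ⟨
    degree union i + sum (λ j → is diag j + is W j) ≡⟨ ∑-distrib-+ (λ j → ind (present (col K i j))) _ ⟨
    sum (λ j → ind (present (col K i j)) + (is diag j + is W j)) ≡⟨ sum-cong-≗ (λ j → pointwise (col K i j)) ⟩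
    sum {n} (λ _ → 1) ≡⟨ sum-one n ⟩
    n ∎
    where
    open ≡-Reasoning
    is : Colour → Fin n → ℕ
    is c j = ind (does (c ≟ col K i j))
    pointwise : ∀ c → ind (present c) + (ind (does (diag ≟ c)) + ind (does (W ≟ c))) ≡ 1
    pointwise diag          = refl
    pointwise W             = refl
    pointwise (suc (suc _)) = refl

even-double : ∀ q → Even (q * 2)
even-double zero    = tt
even-double (suc q) = even-double q

module _ {n} (n-even : Even n) (w b : Fin n → ℕ) {κ} (w+b : ∀ i → w i + b i ≡ κ) (t : ℕ) where

  -- Each stage finds its own slot empty, at most three matchings having been split off before it.
  split-off-four : Colouring (profile w b (4 + t) (λ _ → 0)) →
    Colouring (profile w b t (mark 3F (mark 2F (mark 1F (mark 0F (λ _ → 0))))))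
  split-off-four K =
    recolour t a₃ (mark≤1 2F a₂ (mark≤1 1F a₁ (mark≤1 0F a₀ (λ _ → z≤n)))) 3F refl
    (recolour (1 + t) a₂ (mark≤1 1F a₁ (mark≤1 0F a₀ (λ _ → z≤n))) 2F refl
    (recolour (2 + t) a₁ (mark≤1 0F a₀ (λ _ → z≤n)) 1F refl
    (recolour (3 + t) a₀ (λ _ → z≤n) 0F refl K)))
    where
    open Stage n-even w b w+b using (recolour)
    a₀ a₁ a₂ a₃ : Fin 4 → ℕ
    a₀ = λ _ → 0
    a₁ = mark 0F a₀
    a₂ = mark 1F a₁
    a₃ = mark 2F a₂

theorem1p5 : (k n : ℕ) → 4 ≤ k → 2 ∣ n → (d : Fin n → ℕ) →
    Graphic d → MinusGraphic d k →
    Σ (Graph n) λ G → Realizes G d ×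
    Σ (Graph n) λ F₀ → Σ (Graph n) λ F₁ → Σ (Graph n) λ F₂ →
    Σ (Graph n) λ F₃ → Σ (Graph n) λ F₄ →
    Factor (k ∸ 4) G F₀ × Factor 1 G F₁ × Factor 1 G F₂ ×
    Factor 1 G F₃ × Factor 1 G F₄ ×
    EdgeDisjoint F₀ F₁ × EdgeDisjoint F₀ F₂ × EdgeDisjoint F₀ F₃ ×
    EdgeDisjoint F₀ F₄ × EdgeDisjoint F₁ F₂ × EdgeDisjoint F₁ F₃ ×
    EdgeDisjoint F₁ F₄ × EdgeDisjoint F₂ F₃ × EdgeDisjoint F₂ F₄ ×
    EdgeDisjoint F₃ F₄
theorem1p5 (suc (suc (suc (suc t)))) n (s≤s (s≤s (s≤s (s≤s z≤n)))) (divides q n≡q*2) d (G , G-d) (k≤d , H , H-d) =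
  assemble (split-off-four n-even I.w₀ (degree N.H′) w+b t I.initial)
  where
  k : ℕ
  k = 4 + t
  diff : ∀ i → degree G i ≡ degree H i + k
  diff i = begin
    degree G i     ≡⟨ trans (sym (deg≡degree G i)) (G-d i) ⟩
    d i            ≡⟨ m∸n+n≡m (k≤d i) ⟨
    d i ∸ k + k    ≡⟨ cong (_+ k) (trans (sym (H-d i)) (deg≡degree H i)) ⟩
    degree H i + k ∎
    where open ≡-Reasoning
  module N = Nested (kundu (s≤s z≤n) G H diff)
  diff′ : ∀ i → degree N.G′ i ≡ degree N.H′ i + k
  diff′ i = trans (N.degree-G i) (trans (diff i) (cong (_+ k) (sym (N.degree-H i))))
  module I = Initial N.G′ N.H′ N.nested k diff′
  n-even : Even n
  n-even = subst Even (sym n≡q*2) (even-double q)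
  w+b : ∀ i → I.w₀ i + degree N.H′ i ≡ n ∸ (1 + k)
  w+b i = trans (sym (m+n∸n≡m _ (1 + k))) (cong (_∸ (1 + k)) (I.total-count i))
  assemble : Colouring (profile I.w₀ (degree N.H′) t (mark 3F (mark 2F (mark 1F (mark 0F (λ _ → 0)))))) → _
  assemble K =
    -- What is still red after four stages is the `(k - 4)`-factor; the last four classes are the
    -- matchings.
    union , realizes , class 2F , class 3F , class 4F , class 5F , class 6F ,
    (class⊆union 1F , class-degree (suc 1F)) , (class⊆union 2F , class-degree (suc 2F)) , (class⊆union 3F , class-degree (suc 3F)) , (class⊆union 4F , class-degree (suc 4F)) , (class⊆union 5F , class-degree (suc 5F)) ,
    apart 2F 3F (λ ()) , apart 2F 4F (λ ()) , apart 2F 5F (λ ()) , apart 2F 6F (λ ()) ,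
    apart 3F 4F (λ ()) , apart 3F 5F (λ ()) , apart 3F 6F (λ ()) ,
    apart 4F 5F (λ ()) , apart 4F 6F (λ ()) , apart 5F 6F (λ ())
    where
    open Extract K (λ _ → refl) renaming (class-disjoint to apart)
    realizes : Realizes union d
    realizes i = +-cancelʳ-≡ (1 + I.w₀ i) _ _ (begin
      deg union i + (1 + I.w₀ i)              ≡⟨ union-degree i ⟩
      n                                       ≡⟨ I.total-count i ⟨
      (I.w₀ i + degree N.H′ i) + (1 + k)      ≡⟨ solve 3 (λ x y z → (x :+ y) :+ (con 1 :+ z) := (y :+ z) :+ (con 1 :+ x)) refl (I.w₀ i) (degree N.H′ i) k ⟩
      (degree N.H′ i + k) + (1 + I.w₀ i)      ≡⟨ cong (_+ (1 + I.w₀ i)) (diff′ i) ⟨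
      degree N.G′ i + (1 + I.w₀ i)            ≡⟨ cong (_+ (1 + I.w₀ i)) (trans (N.degree-G i) (trans (sym (deg≡degree G i)) (G-d i))) ⟩
      d i + (1 + I.w₀ i)                      ∎)
      where
      open ≡-Reasoning
      open +-*-Solver
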